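{- Let $K$ be an algebraic number field of possibly infinite degree. Then there is a dense subset ${\sf P}\subset{\sf N}_\bullet[K]$ such that for all $[F]\in{\sf P}$ there exists $[A]\in{\sf N}_\bullet[O_K]$ with $$[A]\otimes[F]\in{\sf N}_\bullet[O_K].$$
   Context: For a finite extension $K/\mathbb{Q}$ let $\mathbb{S}_K=\mathbb{A}_K/(K,+)$ be the adele class group; for $K/\mathbb{Q}$ infinite algebraic, let $\mathbb{S}_K$ denote here the inverse limit of the groups $\mathbb{A}_{K'}/(K',+)$ over finite subextensions $K'\subset K$ along the maps induced by the field traces. It is a compact abelian group with unit mass Haar measure, and its characters $\phi_\alpha$ are canonically indexed by $\alpha\in K$ with $\phi_\alpha\phi_\beta=\phi_{\alpha+\beta}$. Every $f\in L^2(\mathbb{S}_K,\mathbb{C})$ is $f=\sum_{\alpha\in K}a_\alpha\phi_\alpha$ with $(a_\alpha)\in\ell^2(K)$. The Hilbert space ${\sf H}_\bullet[K]$ of graded-holomorphic functions is identified isometrically, by taking boundary values, with $L^2(\mathbb{S}_K,\mathbb{C})\cong\ell^2(K)$; its elements are written $F=\sum_{\alpha\in K}a_\alpha\boldsymbol\varrho^\alpha$, where $\boldsymbol\varrho^\alpha$ has boundary value $\phi_\alpha$. The Dirichlet product of $F=\sum a_\alpha\boldsymbol\varrho^\alpha$ and $G=\sum b_\alpha\boldsymbol\varrho^\alpha$ is $F\otimes G=\sum_\alpha d_\alpha\boldsymbol\varrho^\alpha$, $d_\alpha=\sum_{\alpha_1\alpha_2=\alpha}a_{\alpha_1}b_{\alpha_2}$,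 defined when the expression $d_0=a_0\sum_{\alpha\ne0}b_\alpha+b_0\sum_{\alpha\ne0}a_\alpha+a_0b_0$ converges absolutely and $(d_\alpha)\in\ell^2(K)$. Let ${\sf I}_K\subset{\sf H}_\bullet[K]$ be the set of $F$ with $(a_\alpha)$ absolutely summable and $\sum a_\alpha=0$. Set ${\sf N}_\bullet[K]=({\sf H}_\bullet[K]\setminus{\sf I}_K)/\mathbb{C}^*$, a subspace of the projectivization $\mathbb{P}{\sf H}_\bullet[K]$ (with its usual topology), with the induced partially defined operation $\otimes$ on classes $[F]$. ${\sf N}_\bullet[O_K]\subset{\sf N}_\bullet[K]$ is the set of classes of series with $a_\alpha=0$ for all $\alpha\notin O_K$, where $O_K$ is the ring of algebraic integers of $K$. -}

module Defs where

open import Level using (_⊔_; suc; 0ℓ)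
open import Algebra.Apartness.Bundles using (HeytingCommutativeRing; HeytingField)
open import Algebra.Bundles using (CommutativeRing)
open import Algebra.Core using (Op₂)
open import Algebra.Morphism.Structures using (module RingMorphisms)
open import Data.Integer.Base as ℤ using (ℤ; +_)
import Data.Integer.Properties as ℤ
open import Data.List.Base using (List; []; _∷_; foldr; map; _∷ʳ_)
import Data.List.Relation.Binary.Subset.Setoid as Subset
open import Data.List.Relation.Unary.Any using (Any)
import Data.List.Relation.Unary.Unique.Setoid as Unique
open import Data.Nat.Base as ℕ using (ℕ)
import Data.Nat.Properties as ℕ
open import Data.Product.Relation.Binary.Pointwise.NonDependent using (×-setoid)
open import Data.Product.Base using (Σ-syntax; ∃-syntax; _×_; _,_; proj₁; proj₂)
open import Data.Rational.Base as ℚ using (ℚ; 0ℚ; 1ℚ; ½; _/_)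
import Data.Rational.Properties as ℚ
open import Data.Rational.Solver using (module +-*-Solver)
open import Data.Rational.Unnormalised.Base as ℚᵘ using (mkℚᵘ)
import Data.Rational.Unnormalised.Properties as ℚᵘ
open import Data.Sum.Base using (_⊎_; inj₁; inj₂; map₁)
open import Relation.Binary.Bundles using (Setoid)
import Relation.Binary.Construct.On as On
open import Relation.Binary.Core using (Rel)
open import Relation.Binary.Definitions using (_Respects_)
open import Relation.Binary.PropositionalEquality
  using (_≡_; _≢_; refl; sym; trans; cong; subst; subst₂)
open import Relation.Nullary using (¬_; yes; no; contradiction)
open import Relation.Unary using (Pred)

open +-*-Solver using (solve; _:+_; _:*_; _:-_; :-_; _:=_)

halve : ∀ {ε} → 0ℚ ℚ.< ε → ∃[ δ ] 0ℚ ℚ.< δ × δ ℚ.+ δ ≡ ε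
halve {ε} ε>0 = ½ ℚ.* ε
  , subst (ℚ._< ½ ℚ.* ε) (ℚ.*-zeroʳ ½) (ℚ.*-monoʳ-<-pos ½ ε>0)
  , trans (sym (ℚ.*-distribʳ-+ ε ½ ½)) (ℚ.*-identityˡ ε)

0≤+ : ∀ {p q} → 0ℚ ℚ.≤ p → 0ℚ ℚ.≤ q → 0ℚ ℚ.≤ p ℚ.+ q
0≤+ {p} {q} p≥0 q≥0 =
  subst (ℚ._≤ p ℚ.+ q) (ℚ.+-identityʳ 0ℚ) (ℚ.+-mono-≤ p≥0 q≥0)

0<+ : ∀ {p q} → 0ℚ ℚ.< p → 0ℚ ℚ.≤ q → 0ℚ ℚ.< p ℚ.+ q
0<+ {p} {q} p>0 q≥0 =
  subst (ℚ._< p ℚ.+ q) (ℚ.+-identityʳ 0ℚ) (ℚ.+-mono-<-≤ p>0 q≥0)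

0<* : ∀ {p q} → 0ℚ ℚ.< p → 0ℚ ℚ.< q → 0ℚ ℚ.< p ℚ.* q
0<* {p} {q} p>0 q>0 =
  ℚ.positive⁻¹ _ {{ℚ.pos*pos⇒pos p {{ℚ.positive p>0}} q {{ℚ.positive q>0}}}}

*-mono : ∀ {p q r s} → 0ℚ ℚ.≤ p → p ℚ.≤ q → 0ℚ ℚ.≤ r → r ℚ.≤ s →
         p ℚ.* r ℚ.≤ q ℚ.* s
*-mono {p} {q} {r} {s} 0≤p p≤q 0≤r r≤s = ℚ.≤-trans
  (ℚ.*-monoʳ-≤-nonNeg r {{ℚ.nonNegative 0≤r}} p≤q)
  (ℚ.*-monoˡ-≤-nonNeg q {{ℚ.nonNegative (ℚ.≤-trans 0≤p p≤q)}} r≤s)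

p≤∣p∣ : ∀ p → p ℚ.≤ ℚ.∣ p ∣
p≤∣p∣ p with ℚ.≤-total 0ℚ p
... | inj₁ 0≤p = ℚ.≤-reflexive (sym (ℚ.0≤p⇒∣p∣≡p 0≤p))
... | inj₂ p≤0 = ℚ.≤-trans p≤0 (ℚ.0≤∣p∣ p)

∣p∣<q : ∀ {p q} → p ℚ.< q → ℚ.- p ℚ.< q → ℚ.∣ p ∣ ℚ.< q
∣p∣<q {p} p<q -p<q with ℚ.∣p∣≡p∨∣p∣≡-p p
... | inj₁ eq = subst (ℚ._< _) (sym eq) p<q
... | inj₂ eq = subst (ℚ._< _) (sym eq) -p<q

∣p-q∣<r : ∀ p q {r} → p ℚ.- q ℚ.< r → q ℚ.- p ℚ.< r → ℚ.∣ p ℚ.- q ∣ ℚ.< r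
∣p-q∣<r p q {r} p-q<r q-p<r = ∣p∣<q p-q<r
  (subst (ℚ._< r) (solve 2 (λ p q → q :- p := :- (p :- q)) refl p q) q-p<r)

/-toℚᵘ : ∀ i n → ℚ.toℚᵘ (i / ℕ.suc n) ℚᵘ.≃ mkℚᵘ i n
/-toℚᵘ i n = ℚ.toℚᵘ-fromℚᵘ (mkℚᵘ i n)

grid-suc : ∀ k n → + ℕ.suc k / ℕ.suc n ≡ + k / ℕ.suc n ℚ.+ + 1 / ℕ.suc n
grid-suc k n = ℚ.toℚᵘ-injective (ℚᵘ.≃-trans (/-toℚᵘ (+ ℕ.suc k) n) (ℚᵘ.≃-sym (ℚᵘ.≃-trans
  (ℚ.toℚᵘ-homo-+ (+ k / ℕ.suc n) (+ 1 / ℕ.suc n))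
  (ℚᵘ.≃-trans
    (ℚᵘ.+-cong {_} {mkℚᵘ (+ k) n} {_} {mkℚᵘ (+ 1) n}
      (/-toℚᵘ (+ k) n) (/-toℚᵘ (+ 1) n))
    (ℚᵘ.*≡* eq)))))
  where
  N = + ℕ.suc n
  eq : (+ k ℤ.* N ℤ.+ + 1 ℤ.* N) ℤ.* N ≡ + ℕ.suc k ℤ.* + (ℕ.suc n ℕ.* ℕ.suc n)
  eq = trans
    (cong (ℤ._* N) (trans (sym (ℤ.*-distribʳ-+ N (+ k) (+ 1)))
      (cong (λ m → + m ℤ.* N) (ℕ.+-comm k 1))))
    (trans (ℤ.*-assoc (+ ℕ.suc k) N N)
      (cong (+ ℕ.suc k ℤ.*_) (sym (ℤ.pos-* (ℕ.suc n) (ℕ.suc n)))))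

0≤grid : ∀ k n → 0ℚ ℚ.≤ + k / ℕ.suc n
0≤grid k n = ℚ.nonNegative⁻¹ _ {{ℚ.normalize-nonNeg k (ℕ.suc n)}}

0<mesh : ∀ n → 0ℚ ℚ.< + 1 / ℕ.suc n
0<mesh n = ℚ.positive⁻¹ _ {{ℚ.normalize-pos 1 (ℕ.suc n)}}

mesh-small : ∀ {ε} → 0ℚ ℚ.< ε → ∃[ N ] ∀ n → N ℕ.≤ n → + 1 / ℕ.suc n ℚ.< ε
mesh-small {ε@(ℚ.mkℚ i d _)} ε>0 with ℚ.positive ε>0
mesh-small {ε@(ℚ.mkℚ (+ ℕ.suc p) d _)} ε>0 | _ = ℕ.suc d , λ n d<n →
  ℚ.toℚᵘ-cancel-< (ℚᵘ.<-respˡ-≃ (ℚᵘ.≃-sym (/-toℚᵘ (+ 1) n))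
    (ℚᵘ.*<* (subst₂ ℤ._<_ (sym (ℤ.*-identityˡ (+ ℕ.suc d)))
      (ℤ.pos-* (ℕ.suc p) (ℕ.suc n))
      (ℤ.+<+ (ℕ.≤-trans (ℕ.s≤s d<n) (ℕ.m≤m+n (ℕ.suc n) (p ℕ.* ℕ.suc n)))))))

Cauchy : (ℕ → ℚ) → Set
Cauchy x = ∀ ε → 0ℚ ℚ.< ε →
  ∃[ N ] ∀ m n → N ℕ.≤ m → N ℕ.≤ n → ℚ.∣ x m ℚ.- x n ∣ ℚ.< ε

record ℝ : Set where
  constructor mkℝ
  field
    seq    : ℕ → ℚ
    cauchy : Cauchy seq

open ℝ public

infix 4 _≈ᴿ_ _<ᴿ_

_≈ᴿ_ : Rel ℝ 0ℓ
x ≈ᴿ y = ∀ ε → 0ℚ ℚ.< ε →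
  ∃[ N ] ∀ n → N ℕ.≤ n → ℚ.∣ seq x n ℚ.- seq y n ∣ ℚ.< ε

-- The gap ε is needed: a pointwise strict inequality gives only ≤ in the limit.
_<ᴿ_ : Rel ℝ 0ℓ
x <ᴿ y = ∃[ ε ] 0ℚ ℚ.< ε × ∃[ N ] ∀ n → N ℕ.≤ n → seq x n ℚ.+ ε ℚ.< seq y n

abstract

  const-cauchy : ∀ p → Cauchy (λ _ → p)
  const-cauchy p ε ε>0 = 0 , λ _ _ _ _ →
    subst (λ q → ℚ.∣ q ∣ ℚ.< ε) (sym (ℚ.+-inverseʳ p)) ε>0

fromℚ : ℚ → ℝ
fromℚ p = mkℝ (λ _ → p) (const-cauchy p)

0ᴿ 1ᴿ : ℝ
0ᴿ = fromℚ 0ℚ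
1ᴿ = fromℚ 1ℚ

eventually-bounded : ∀ {x} → Cauchy x →
  ∃[ B ] 0ℚ ℚ.< B × ∃[ N ] ∀ n → N ℕ.≤ n → ℚ.∣ x n ∣ ℚ.≤ B
eventually-bounded {x} cx =
  let N , hN = cx 1ℚ (ℚ.positive⁻¹ 1ℚ) in
  1ℚ ℚ.+ ℚ.∣ x N ∣
  , 0<+ (ℚ.positive⁻¹ 1ℚ) (ℚ.0≤∣p∣ (x N))
  , N , λ n n≥ → ℚ.≤-trans
      (subst (λ q → ℚ.∣ q ∣ ℚ.≤ ℚ.∣ x n ℚ.- x N ∣ ℚ.+ ℚ.∣ x N ∣)
        (solve 2 (λ a b → (a :- b) :+ b := a) refl (x n) (x N))
        (ℚ.∣p+q∣≤∣p∣+∣q∣ (x n ℚ.- x N) (x N)))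
      (ℚ.+-monoˡ-≤ ℚ.∣ x N ∣ (ℚ.<⇒≤ (hN n N n≥ ℕ.≤-refl)))

divide : ∀ {ε B} → 0ℚ ℚ.< ε → 0ℚ ℚ.< B → ∃[ δ ] 0ℚ ℚ.< δ × B ℚ.* δ ≡ ε
divide {ε} {B} ε>0 B>0 =
  B⁻¹ ℚ.* ε
  , 0<* {B⁻¹} (ℚ.positive⁻¹ B⁻¹ {{ℚ.1/pos⇒pos B}}) ε>0
  , trans (sym (ℚ.*-assoc B B⁻¹ ε))
      (trans (cong (ℚ._* ε) (ℚ.*-inverseʳ B)) (ℚ.*-identityˡ ε))
  where
  instance
    B-pos = ℚ.positive B>0
    B≢0 = ℚ.pos⇒nonZero B
  B⁻¹ = ℚ.1/ B

product-bound : ∀ {p q B δ} → 0ℚ ℚ.< B → ℚ.∣ p ∣ ℚ.≤ B → ℚ.∣ q ∣ ℚ.< δ →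
  ℚ.∣ p ℚ.* q ∣ ℚ.< B ℚ.* δ
product-bound {p} {q} {B} B>0 p≤B q<δ = ℚ.≤-<-trans
  (subst (ℚ._≤ B ℚ.* ℚ.∣ q ∣) (sym (ℚ.∣p*q∣≡∣p∣*∣q∣ p q))
    (ℚ.*-monoʳ-≤-nonNeg ℚ.∣ q ∣ {{ℚ.∣-∣-nonNeg q}} p≤B))
  (ℚ.*-monoʳ-<-pos B {{ℚ.positive B>0}} q<δ)

abstract

  +-cauchy : ∀ {x y} → Cauchy x → Cauchy y → Cauchy (λ n → x n ℚ.+ y n)
  +-cauchy {x} {y} cx cy ε ε>0 =
    let δ , δ>0 , 2δ = halve ε>0
        M , hM = cx δ δ>0
        N , hN = cy δ δ>0
    in M ℕ.⊔ N , λ m n m≥ n≥ → ℚ.≤-<-trans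
      (subst (λ q → ℚ.∣ q ∣ ℚ.≤ ℚ.∣ x m ℚ.- x n ∣ ℚ.+ ℚ.∣ y m ℚ.- y n ∣)
        (solve 4 (λ a b c d → (a :- b) :+ (c :- d) := (a :+ c) :- (b :+ d)) refl
          (x m) (x n) (y m) (y n))
        (ℚ.∣p+q∣≤∣p∣+∣q∣ (x m ℚ.- x n) (y m ℚ.- y n)))
      (subst (ℚ.∣ x m ℚ.- x n ∣ ℚ.+ ℚ.∣ y m ℚ.- y n ∣ ℚ.<_) 2δ
        (ℚ.+-mono-<
          (hM m n (ℕ.m⊔n≤o⇒m≤o M N m≥) (ℕ.m⊔n≤o⇒m≤o M N n≥))
          (hN m n (ℕ.m⊔n≤o⇒n≤o M N m≥) (ℕ.m⊔n≤o⇒n≤o M N n≥))))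

  neg-cauchy : ∀ {x} → Cauchy x → Cauchy (λ n → ℚ.- x n)
  neg-cauchy {x} cx ε ε>0 =
    let N , hN = cx ε ε>0
    in N , λ m n m≥ n≥ → subst (λ q → ℚ.∣ q ∣ ℚ.< ε)
      (solve 2 (λ a b → b :- a := :- a :- (:- b)) refl (x m) (x n))
      (hN n m n≥ m≥)

  *-cauchy : ∀ {x y} → Cauchy x → Cauchy y → Cauchy (λ n → x n ℚ.* y n)
  *-cauchy {x} {y} cx cy ε ε>0 =
    let δ , δ>0 , 2δ = halve ε>0
        B , B>0 , I , hB = eventually-bounded {x} cx
        C , C>0 , J , hC = eventually-bounded {y} cy
        η , η>0 , Bη = divide δ>0 B>0
        θ , θ>0 , Cθ = divide δ>0 C>0
        M , hM = cx θ θ>0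
        N , hN = cy η η>0
        K = (I ℕ.⊔ J) ℕ.⊔ (M ℕ.⊔ N)
        ≥I : ∀ {n} → K ℕ.≤ n → I ℕ.≤ n
        ≥I n≥ = ℕ.m⊔n≤o⇒m≤o I J (ℕ.m⊔n≤o⇒m≤o (I ℕ.⊔ J) (M ℕ.⊔ N) n≥)
        ≥J : ∀ {n} → K ℕ.≤ n → J ℕ.≤ n
        ≥J n≥ = ℕ.m⊔n≤o⇒n≤o I J (ℕ.m⊔n≤o⇒m≤o (I ℕ.⊔ J) (M ℕ.⊔ N) n≥)
        ≥M : ∀ {n} → K ℕ.≤ n → M ℕ.≤ n
        ≥M n≥ = ℕ.m⊔n≤o⇒m≤o M N (ℕ.m⊔n≤o⇒n≤o (I ℕ.⊔ J) (M ℕ.⊔ N) n≥)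
        ≥N : ∀ {n} → K ℕ.≤ n → N ℕ.≤ n
        ≥N n≥ = ℕ.m⊔n≤o⇒n≤o M N (ℕ.m⊔n≤o⇒n≤o (I ℕ.⊔ J) (M ℕ.⊔ N) n≥)
    in K , λ m n m≥ n≥ →
      let p = x m ℚ.* (y m ℚ.- y n)
          q = y n ℚ.* (x m ℚ.- x n)
      in ℚ.≤-<-trans
        (subst (λ r → ℚ.∣ r ∣ ℚ.≤ ℚ.∣ p ∣ ℚ.+ ℚ.∣ q ∣)
          (solve 4 (λ a b c d → a :* (c :- d) :+ d :* (a :- b) := a :* c :- b :* d)
            refl (x m) (x n) (y m) (y n))
          (ℚ.∣p+q∣≤∣p∣+∣q∣ p q))
        (subst (ℚ.∣ p ∣ ℚ.+ ℚ.∣ q ∣ ℚ.<_) 2δ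
          (ℚ.+-mono-<
            (subst (ℚ.∣ p ∣ ℚ.<_) Bη
              (product-bound {x m} B>0 (hB m (≥I m≥)) (hN m n (≥N m≥) (≥N n≥))))
            (subst (ℚ.∣ q ∣ ℚ.<_) Cθ
              (product-bound {y n} C>0 (hC n (≥J n≥)) (hM m n (≥M m≥) (≥M n≥))))))

  ∣-∣-cauchy : ∀ {x} → Cauchy x → Cauchy (λ n → ℚ.∣ x n ∣)
  ∣-∣-cauchy {x} cx ε ε>0 =
    let N , hN = cx ε ε>0
    in N , λ m n m≥ n≥ → ∣p-q∣<r ℚ.∣ x m ∣ ℚ.∣ x n ∣
      (ℚ.≤-<-trans (reverse-triangle (x m) (x n)) (hN m n m≥ n≥))
      (ℚ.≤-<-trans (reverse-triangle (x n) (x m)) (hN n m n≥ m≥))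
    where
    reverse-triangle : ∀ p q → ℚ.∣ p ∣ ℚ.- ℚ.∣ q ∣ ℚ.≤ ℚ.∣ p ℚ.- q ∣
    reverse-triangle p q = subst (ℚ.∣ p ∣ ℚ.- ℚ.∣ q ∣ ℚ.≤_)
      (solve 2 (λ a b → a :+ b :- b := a) refl ℚ.∣ p ℚ.- q ∣ ℚ.∣ q ∣)
      (ℚ.+-monoˡ-≤ (ℚ.- ℚ.∣ q ∣)
        (subst (λ r → ℚ.∣ r ∣ ℚ.≤ ℚ.∣ p ℚ.- q ∣ ℚ.+ ℚ.∣ q ∣)
          (solve 2 (λ a b → (a :- b) :+ b := a) refl p q)
          (ℚ.∣p+q∣≤∣p∣+∣q∣ (p ℚ.- q) q)))

infix  8 -ᴿ_
infixl 7 _*ᴿ_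
infixl 6 _+ᴿ_ _-ᴿ_

_+ᴿ_ : ℝ → ℝ → ℝ
x +ᴿ y = mkℝ (λ n → seq x n ℚ.+ seq y n)
  (+-cauchy {seq x} {seq y} (cauchy x) (cauchy y))

-ᴿ_ : ℝ → ℝ
-ᴿ x = mkℝ (λ n → ℚ.- seq x n) (neg-cauchy {seq x} (cauchy x))

_-ᴿ_ : ℝ → ℝ → ℝ
x -ᴿ y = x +ᴿ -ᴿ y

_*ᴿ_ : ℝ → ℝ → ℝ
x *ᴿ y = mkℝ (λ n → seq x n ℚ.* seq y n)
  (*-cauchy {seq x} {seq y} (cauchy x) (cauchy y))

∣_∣ᴿ : ℝ → ℝ
∣ x ∣ᴿ = mkℝ (λ n → ℚ.∣ seq x n ∣) (∣-∣-cauchy {seq x} (cauchy x))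

-- The largest k ≤ b with (g k)² ≤ q, or 0 if there is none.
search : (ℕ → ℚ) → ℚ → ℕ → ℕ
search g q ℕ.zero = 0
search g q (ℕ.suc b) with g (ℕ.suc b) ℚ.* g (ℕ.suc b) ℚ.≤? q
... | yes _ = ℕ.suc b
... | no  _ = search g q b

-- √ q rounded down to a multiple of 1 / (n + 1); the search starts at a point
-- of the grid that is at least ∣ q ∣ and at least 1.
sqrtIndex : ℕ → ℚ → ℕ
sqrtIndex n q =
  search (λ k → + k / ℕ.suc n) q (ℕ.suc n ℕ.* ℕ.suc ℤ.∣ ℚ.↥ q ∣)

approx√ : ℕ → ℚ → ℚ
approx√ n q = + sqrtIndex n q / ℕ.suc n

search-lower : ∀ (g : ℕ → ℚ) q b →
  search g q b ≡ 0 ⊎ g (search g q b) ℚ.* g (search g q b) ℚ.≤ q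
search-lower g q ℕ.zero = inj₁ refl
search-lower g q (ℕ.suc b) with g (ℕ.suc b) ℚ.* g (ℕ.suc b) ℚ.≤? q
... | yes ≤q = inj₂ ≤q
... | no  _  = search-lower g q b

search-upper : ∀ (g : ℕ → ℚ) q b → q ℚ.< g (ℕ.suc b) ℚ.* g (ℕ.suc b) →
  q ℚ.< g (ℕ.suc (search g q b)) ℚ.* g (ℕ.suc (search g q b))
search-upper g q ℕ.zero q< = q<
search-upper g q (ℕ.suc b) q< with g (ℕ.suc b) ℚ.* g (ℕ.suc b) ℚ.≤? q
... | yes _ = q<
... | no ≰q = search-upper g q b (ℚ.≰⇒> ≰q)

-- If √ p ≥ √ q + 2δ, with √ q rounded down by at most h < δ, then
-- p ≥ (√ q + 2δ)² ≥ q + δ².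
sqrt-gap : ∀ {δ h p q s t} → 0ℚ ℚ.< δ → 0ℚ ℚ.< h → h ℚ.< δ → 0ℚ ℚ.≤ t →
  s ≡ 0ℚ ⊎ s ℚ.* s ℚ.≤ p → q ℚ.< (t ℚ.+ h) ℚ.* (t ℚ.+ h) →
  ℚ.∣ p ℚ.- q ∣ ℚ.< δ ℚ.* δ → s ℚ.- t ℚ.< δ ℚ.+ δ
sqrt-gap {δ} {h} {p} {q} {s} {t} δ>0 h>0 h<δ 0≤t lower upper pq<
  with (δ ℚ.+ δ) ℚ.≤? (s ℚ.- t)
... | no ≰    = ℚ.≰⇒> ≰
... | yes 2δ≤ = contradiction (δ²+q<p lower) (ℚ.<-asym p<δ²+q)
  where
  open ℚ.≤-Reasoning
  u = t ℚ.+ h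
  0≤u : 0ℚ ℚ.≤ u
  0≤u = 0≤+ 0≤t (ℚ.<⇒≤ h>0)
  u+δ≤s : u ℚ.+ δ ℚ.≤ s
  u+δ≤s = begin
    u ℚ.+ δ             ≤⟨ ℚ.+-monoˡ-≤ δ (ℚ.+-monoʳ-≤ t (ℚ.<⇒≤ h<δ)) ⟩
    (t ℚ.+ δ) ℚ.+ δ     ≡⟨ ℚ.+-assoc t δ δ ⟩
    t ℚ.+ (δ ℚ.+ δ)     ≤⟨ ℚ.+-monoʳ-≤ t 2δ≤ ⟩
    t ℚ.+ (s ℚ.- t)     ≡⟨ solve 2 (λ s t → t :+ (s :- t) := s) refl s t ⟩
    s                   ∎
  0<u+δ : 0ℚ ℚ.< u ℚ.+ δ
  0<u+δ = subst (0ℚ ℚ.<_) (ℚ.+-comm δ u) (0<+ δ>0 0≤u)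
  p<δ²+q : p ℚ.< δ ℚ.* δ ℚ.+ q
  p<δ²+q = begin-strict
    p                       ≡⟨ solve 2 (λ p q → p := p :- q :+ q) refl p q ⟩
    p ℚ.- q ℚ.+ q           ≤⟨ ℚ.+-monoˡ-≤ q (p≤∣p∣ (p ℚ.- q)) ⟩
    ℚ.∣ p ℚ.- q ∣ ℚ.+ q     <⟨ ℚ.+-monoˡ-< q pq< ⟩
    δ ℚ.* δ ℚ.+ q           ∎
  0≤uδ : 0ℚ ℚ.≤ u ℚ.* δ
  0≤uδ = subst (ℚ._≤ u ℚ.* δ) (ℚ.*-zeroʳ 0ℚ)
    (*-mono ℚ.≤-refl 0≤u ℚ.≤-refl (ℚ.<⇒≤ δ>0))
  δ²+q<p : s ≡ 0ℚ ⊎ s ℚ.* s ℚ.≤ p → δ ℚ.* δ ℚ.+ q ℚ.< p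
  δ²+q<p (inj₁ s≡0) = contradiction
    (ℚ.<-≤-trans 0<u+δ (ℚ.≤-trans u+δ≤s (ℚ.≤-reflexive s≡0))) (ℚ.<-irrefl refl)
  δ²+q<p (inj₂ s²≤p) = begin-strict
    v ℚ.+ q                       <⟨ ℚ.+-monoʳ-< v upper ⟩
    v ℚ.+ u ℚ.* u                 ≡⟨ sym (ℚ.+-identityˡ (v ℚ.+ u ℚ.* u)) ⟩
    0ℚ ℚ.+ (v ℚ.+ u ℚ.* u)        ≤⟨ ℚ.+-monoˡ-≤ (v ℚ.+ u ℚ.* u) (0≤+ 0≤uδ 0≤uδ) ⟩
    (u ℚ.* δ ℚ.+ u ℚ.* δ) ℚ.+ (v ℚ.+ u ℚ.* u)
      ≡⟨ solve 2 (λ u d → (u :* d :+ u :* d) :+ (d :* d :+ u :* u)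
                          := (u :+ d) :* (u :+ d)) refl u δ ⟩
    (u ℚ.+ δ) ℚ.* (u ℚ.+ δ)
      ≤⟨ *-mono (ℚ.<⇒≤ 0<u+δ) u+δ≤s (ℚ.<⇒≤ 0<u+δ) u+δ≤s ⟩
    s ℚ.* s                       ≤⟨ s²≤p ⟩
    p                             ∎
    where
    v = δ ℚ.* δ

q<t² : ∀ {q s h} → q ℚ.≤ s → 1ℚ ℚ.≤ s → 0ℚ ℚ.< h →
  q ℚ.< (s ℚ.+ h) ℚ.* (s ℚ.+ h)
q<t² {q} {s} {h} q≤s 1≤s h>0 = begin-strict
  q               ≤⟨ q≤s ⟩
  s               ≡⟨ sym (ℚ.*-identityʳ s) ⟩
  s ℚ.* 1ℚ        ≤⟨ *-mono 0≤s (ℚ.≤-refl {s}) (ℚ.<⇒≤ (ℚ.positive⁻¹ 1ℚ)) 1≤s ⟩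
  s ℚ.* s         ≤⟨ *-mono 0≤s (ℚ.≤-refl {s}) 0≤s (ℚ.<⇒≤ s<t) ⟩
  s ℚ.* t         <⟨ ℚ.*-monoˡ-<-pos t {{ℚ.positive (ℚ.≤-<-trans 0≤s s<t)}} s<t ⟩
  t ℚ.* t         ∎
  where
  open ℚ.≤-Reasoning
  t = s ℚ.+ h
  0≤s : 0ℚ ℚ.≤ s
  0≤s = ℚ.≤-trans (ℚ.<⇒≤ (ℚ.positive⁻¹ 1ℚ)) 1≤s
  s<t : s ℚ.< t
  s<t = subst (ℚ._< t) (ℚ.+-identityʳ s) (ℚ.+-monoʳ-< s h>0)

bound-≥ : ∀ n q → q ℚ.≤ + (ℕ.suc n ℕ.* ℕ.suc ℤ.∣ ℚ.↥ q ∣) / ℕ.suc n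
bound-≥ n q@(ℚ.mkℚ i d _) = ℚ.toℚᵘ-cancel-≤
  (ℚᵘ.≤-respʳ-≃ (ℚᵘ.≃-sym (/-toℚᵘ (+ (ℕ.suc n ℕ.* a)) n)) (ℚᵘ.*≤* (begin
    i ℤ.* + ℕ.suc n                       ≤⟨ ℤ.*-monoʳ-≤-nonNeg (+ ℕ.suc n) (i≤ i) ⟩
    + a ℤ.* + ℕ.suc n                     ≡⟨ sym (ℤ.pos-* a (ℕ.suc n)) ⟩
    + (a ℕ.* ℕ.suc n)                     ≡⟨ cong +_ (ℕ.*-comm a (ℕ.suc n)) ⟩
    + (ℕ.suc n ℕ.* a)                     ≤⟨ ℤ.+≤+ (ℕ.m≤m*n (ℕ.suc n ℕ.* a) (ℕ.suc d)) ⟩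
    + (ℕ.suc n ℕ.* a ℕ.* ℕ.suc d)         ≡⟨ ℤ.pos-* (ℕ.suc n ℕ.* a) (ℕ.suc d) ⟩
    + (ℕ.suc n ℕ.* a) ℤ.* + ℕ.suc d       ∎)))
  where
  open ℤ.≤-Reasoning
  a = ℕ.suc ℤ.∣ i ∣
  i≤ : ∀ i → i ℤ.≤ + ℕ.suc ℤ.∣ i ∣
  i≤ (+ k)      = ℤ.+≤+ (ℕ.n≤1+n k)
  i≤ ℤ.-[1+ k ] = ℤ.-≤+

1≤bound : ∀ n a → 1ℚ ℚ.≤ + (ℕ.suc n ℕ.* ℕ.suc a) / ℕ.suc n
1≤bound n a = ℚ.toℚᵘ-cancel-≤
  (ℚᵘ.≤-respʳ-≃ (ℚᵘ.≃-sym (/-toℚᵘ (+ (ℕ.suc n ℕ.* ℕ.suc a)) n)) (ℚᵘ.*≤*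
    (subst₂ ℤ._≤_ (sym (ℤ.*-identityˡ (+ ℕ.suc n)))
      (sym (ℤ.*-identityʳ (+ (ℕ.suc n ℕ.* ℕ.suc a))))
      (ℤ.+≤+ (ℕ.m≤m*n (ℕ.suc n) (ℕ.suc a))))))

approx√-lower : ∀ n q →
  approx√ n q ≡ 0ℚ ⊎ approx√ n q ℚ.* approx√ n q ℚ.≤ q
approx√-lower n q =
  map₁
    (λ eq → trans (cong (λ k → + k / ℕ.suc n) eq) (ℚ.0/n≡0 (ℕ.suc n)))
    (search-lower (λ k → + k / ℕ.suc n) q (ℕ.suc n ℕ.* ℕ.suc ℤ.∣ ℚ.↥ q ∣))

approx√-upper : ∀ n q →
  q ℚ.< (approx√ n q ℚ.+ + 1 / ℕ.suc n) ℚ.* (approx√ n q ℚ.+ + 1 / ℕ.suc n)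
approx√-upper n q = <square (grid-suc (sqrtIndex n q) n)
  (search-upper g q b (<square (sym (grid-suc b n))
    (q<t² (bound-≥ n q) (1≤bound n ℤ.∣ ℚ.↥ q ∣) (0<mesh n))))
  where
  g : ℕ → ℚ
  g k = + k / ℕ.suc n
  b = ℕ.suc n ℕ.* ℕ.suc ℤ.∣ ℚ.↥ q ∣
  <square : ∀ {r s} → r ≡ s → q ℚ.< r ℚ.* r → q ℚ.< s ℚ.* s
  <square eq = subst (λ r → q ℚ.< r ℚ.* r) eq

approx√-close : ∀ {δ p q} m n → 0ℚ ℚ.< δ → + 1 / ℕ.suc n ℚ.< δ →
  ℚ.∣ p ℚ.- q ∣ ℚ.< δ ℚ.* δ → approx√ m p ℚ.- approx√ n q ℚ.< δ ℚ.+ δ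
approx√-close {δ} {p} {q} m n δ>0 h<δ =
  sqrt-gap δ>0 (0<mesh n) h<δ (0≤grid (sqrtIndex n q) n)
    (approx√-lower m p) (approx√-upper n q)

abstract

  sqrt-cauchy : ∀ {x} → Cauchy x → Cauchy (λ n → approx√ n (x n))
  sqrt-cauchy {x} cx ε ε>0 =
    let δ , δ>0 , 2δ = halve ε>0
        M , hM = cx (δ ℚ.* δ) (0<* δ>0 δ>0)
        N , hN = mesh-small δ>0
        close : ∀ m n → M ℕ.⊔ N ℕ.≤ m → M ℕ.⊔ N ℕ.≤ n →
                approx√ m (x m) ℚ.- approx√ n (x n) ℚ.< ε
        close m n m≥ n≥ = ℚ.<-≤-trans
          (approx√-close {δ} {x m} {x n} m n δ>0 (hN n (ℕ.m⊔n≤o⇒n≤o M N n≥))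
            (hM m n (ℕ.m⊔n≤o⇒m≤o M N m≥) (ℕ.m⊔n≤o⇒m≤o M N n≥)))
          (ℚ.≤-reflexive 2δ)
    in M ℕ.⊔ N , λ m n m≥ n≥ → ∣p-q∣<r (approx√ m (x m)) (approx√ n (x n))
      (close m n m≥ n≥) (close n m n≥ m≥)

-- The square root of the positive part.
√ : ℝ → ℝ
√ x = mkℝ (λ n → approx√ n (seq x n)) (sqrt-cauchy {seq x} (cauchy x))

record ℂ : Set where
  constructor _+i_
  field
    re im : ℝ

open ℂ public

infix 4 _≈ᶜ_

_≈ᶜ_ : Rel ℂ 0ℓ
z ≈ᶜ w = re z ≈ᴿ re w × im z ≈ᴿ im w

0ᶜ 1ᶜ : ℂ
0ᶜ = 0ᴿ +i 0ᴿ
1ᶜ = 1ᴿ +i 0ᴿ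

infixl 7 _*ᶜ_
infixl 6 _+ᶜ_ _-ᶜ_

_+ᶜ_ _-ᶜ_ _*ᶜ_ : ℂ → ℂ → ℂ
z +ᶜ w = (re z +ᴿ re w) +i (im z +ᴿ im w)
z -ᶜ w = (re z -ᴿ re w) +i (im z -ᴿ im w)
z *ᶜ w = (re z *ᴿ re w -ᴿ im z *ᴿ im w) +i (re z *ᴿ im w +ᴿ im z *ᴿ re w)

∣_∣² ∣_∣ᶜ : ℂ → ℝ
∣ z ∣² = re z *ᴿ re z +ᴿ im z *ᴿ im z
∣ z ∣ᶜ = √ ∣ z ∣²

ℂ* : Pred ℂ 0ℓ
ℂ* z = ∃[ w ] z *ᶜ w ≈ᶜ 1ᶜ

-- Unconditional sums over a setoid: limits along its finite subsets, which are
-- represented by duplicate-free lists.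
module Summation {a} {A : Set a} (_+_ : Op₂ A) (0# : A) (dist : A → A → ℝ)
                 {c ℓ} (I : Setoid c ℓ) where

  open Setoid I using () renaming (Carrier to Index)
  open Subset I using (_⊆_)
  open Unique I using (Unique)

  finiteSum : (Index → A) → List Index → A
  finiteSum f = foldr (λ i s → f i + s) 0#

  HasSum : (Index → A) → A → Set (c ⊔ ℓ)
  HasSum f s = ∀ ε → 0ᴿ <ᴿ ε →
    ∃[ S₀ ] ∀ S → Unique S → S₀ ⊆ S → dist (finiteSum f S) s <ᴿ ε

distᴿ : ℝ → ℝ → ℝ
distᴿ x y = ∣ x -ᴿ y ∣ᴿ

distᶜ : ℂ → ℂ → ℝ
distᶜ z w = ∣ z -ᶜ w ∣ᶜ

module _ {c ℓ} (I : Setoid c ℓ) where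

  open Summation _+ᴿ_ 0ᴿ distᴿ I public
    using () renaming (HasSum to HasSumᴿ; finiteSum to finiteSumᴿ)
  open Summation _+ᶜ_ 0ᶜ distᶜ I public
    using () renaming (HasSum to HasSumᶜ; finiteSum to finiteSumᶜ)

  AbsSummable : (Setoid.Carrier I → ℂ) → Set (c ⊔ ℓ)
  AbsSummable f = ∃[ s ] HasSumᴿ (λ i → ∣ f i ∣ᶜ) s

module _ {c ℓ} (R : CommutativeRing c ℓ) where

  open CommutativeRing R

  -- The value at x of the polynomial with the given coefficients, lowest degree
  -- first, mapped into R by φ.
  evalPoly : (ℚ → Carrier) → List ℚ → Carrier → Carrier
  evalPoly φ p x = foldr (λ a r → φ a + x * r) 0# p

-- The apartness of a Heyting field is classically the negation of equality, and
-- the library's notion does not exclude the zero ring.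
record AlgebraicNumberField c ℓ₁ ℓ₂ : Set (suc (c ⊔ ℓ₁ ⊔ ℓ₂)) where
  field
    heytingField : HeytingField c ℓ₁ ℓ₂

  open HeytingField heytingField public

  commutativeRing : CommutativeRing c ℓ₁
  commutativeRing = HeytingCommutativeRing.commutativeRing heytingCommutativeRing

  open CommutativeRing commutativeRing public using (rawRing)
  open RingMorphisms ℚ.+-*-rawRing rawRing using (IsRingHomomorphism)

  field
    1#0#      : 1# # 0#
    ι         : ℚ → Carrier
    ι-hom     : IsRingHomomorphism ι
    algebraic : ∀ x → ∃[ p ] Any (_≢ 0ℚ) p × evalPoly commutativeRing ι p x ≈ 0#

  -- The leading coefficient 1 comes last.
  IsIntegral : Pred Carrier ℓ₁
  IsIntegral x = Σ[ p ∈ List ℤ ]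
    evalPoly commutativeRing ι (map (_/ 1) p ∷ʳ 1ℚ) x ≈ 0#

module GradedHolomorphic {c ℓ₁ ℓ₂} (K : AlgebraicNumberField c ℓ₁ ℓ₂) where

  open AlgebraicNumberField K
    using (Carrier; _≈_; _*_; 0#; setoid; IsIntegral)

  -- The element ∑ coeff α · ϱ^α, given by its coefficients through the isometry
  -- of H∙[K] with ℓ²(K).
  record H : Set (c ⊔ ℓ₁) where
    field
      coeff      : Carrier → ℂ
      coeff-cong : ∀ {α β} → α ≈ β → coeff α ≈ᶜ coeff β
      coeff-ℓ²   : ∃[ s ] HasSumᴿ setoid (λ α → ∣ coeff α ∣²) s

  open H public

  IsZero : Pred H c
  IsZero F = ∀ α → coeff F α ≈ᶜ 0ᶜ

  ‖_-_‖<_ : H → H → ℝ → Set (c ⊔ ℓ₁)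
  ‖ F - G ‖< ε =
    ∃[ s ] HasSumᴿ setoid (λ α → ∣ coeff F α -ᶜ coeff G α ∣²) s × s <ᴿ ε *ᴿ ε

  infix 4 _∝_ _∼_

  _∝_ : Rel H c
  F ∝ G = ∃[ k ] ℂ* k × (∀ α → coeff F α ≈ᶜ k *ᶜ coeff G α)

  -- Points of the projective space are represented by nonzero vectors; subsets
  -- are predicates respecting _∼_.
  record ℙH : Set (c ⊔ ℓ₁) where
    field
      rep     : H
      nonzero : ¬ IsZero rep

  open ℙH public

  _∼_ : Rel ℙH c
  F ∼ G = rep F ∝ rep G

  -- The quotient of the norm topology on H∙[K] ∖ {0}.
  IsOpen : ∀ {v} → Pred ℙH v → Set (c ⊔ ℓ₁ ⊔ v)
  IsOpen V = V Respects _∼_ ×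
    (∀ F → V F → ∃[ ε ] 0ᴿ <ᴿ ε × (∀ G → ‖ rep G - rep F ‖< ε → V G))

  -- P is dense in X for the subspace topology of X: every open set of ℙH that
  -- meets X meets X ∩ P.
  DenseIn : ∀ v {x p} → Pred ℙH x → Pred ℙH p → Set (c ⊔ ℓ₁ ⊔ x ⊔ p ⊔ suc v)
  DenseIn v X P = ∀ (V : Pred ℙH v) → IsOpen V →
    ∀ F → X F → V F → ∃[ G ] X G × P G × V G

  I : Pred H (c ⊔ ℓ₁)
  I F = AbsSummable setoid (coeff F) × HasSumᶜ setoid (coeff F) 0ᶜ

  N : Pred ℙH (c ⊔ ℓ₁)
  N F = ¬ I (rep F)

  N[O] : Pred ℙH (c ⊔ ℓ₁)
  N[O] F = N F × (∀ α → ¬ IsIntegral α → coeff (rep F) α ≈ᶜ 0ᶜ)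

  factorizations : Carrier → Setoid (c ⊔ ℓ₁) ℓ₁
  factorizations α = record
    { Carrier = Σ[ p ∈ Carrier × Carrier ] proj₁ p * proj₂ p ≈ α
    ; _≈_     = λ p q → Setoid._≈_ (×-setoid setoid setoid) (proj₁ p) (proj₁ q)
    ; isEquivalence = On.isEquivalence proj₁ (Setoid.isEquivalence (×-setoid setoid setoid))
    }

  term : H → H → ∀ α → Setoid.Carrier (factorizations α) → ℂ
  term F G α ((α₁ , α₂) , _) = coeff F α₁ *ᶜ coeff G α₂

  -- F ⊗ G is defined and equal to D.  Over α = 0 the factorizations are (0 , α),
  -- (α , 0) with α ≠ 0 and (0 , 0), so that the sum is
  -- a₀ ∑ b_α + b₀ ∑ a_α + a₀ b₀, which is required to converge absolutely.
  IsDirichletProduct : H → H → H → Set (c ⊔ ℓ₁)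
  IsDirichletProduct F G D =
    AbsSummable (factorizations 0#) (term F G 0#) ×
    (∀ α → HasSumᶜ (factorizations α) (term F G α) (coeff D α))

  -- The product of classes is defined on representatives and equal to [ D ].
  [_]⊗[_]≡[_] : ℙH → ℙH → ℙH → Set (c ⊔ ℓ₁)
  [ F ]⊗[ G ]≡[ D ] = ∃[ E ] IsDirichletProduct (rep F) (rep G) E × E ∝ rep D

{-# OPTIONS --safe #-}
module Submission where

-- P consists of the classes of the elements F with finite support whose
-- coefficients have nonzero sum.
--
-- Such an F lies in N, since a finite sum is its own unconditional sum.  Every
-- element of K has a multiple by a nonzero integer that is an algebraic integer;
-- a common denominator n of the support of F gives A = ϱ^n, and
-- A ⊗ F = ∑ a_α ϱ^(nα), because each β has exactly one factorization
-- β = n · (β / n) in which the first factor lies in the support of A.  This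
-- product has integral support and the same sum of coefficients as F, so that it
-- lies in N[O], as does A (common-denominator, denominator⇒integral,
-- monomial-product, P-integral-multiple).
--
-- P is dense even in the whole projective space: given F and a radius ε, the
-- coefficients of F are cut off outside a finite set S that contains 0 and carries
-- all but a small part of the ℓ² norm, and a small rational t is added to the
-- coefficient at 0.  The two candidates t = ± δ leave the distance to F the same;
-- a rational approximation of the sum over S tells which of them makes the new
-- sum nonzero (perturb, truncation-estimate, approximation).
--
-- The truncation needs a decision of membership in S, hence of equality in K,
-- which is not part of the structure of a Heyting field.  It is available because
-- K is algebraic: if p(x) = 0 with p = X^k q and q(0) ≠ 0, then
-- q(0) = q(x) - x r(x) is a unit, so by cotransitivity q(x) or x is a unit.  In
-- the former case x^k = 0, so that x is not a unit and is 0 by tightness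
-- (unit-or-eval-unit, ≈0?).

open import Defs
open import Level using (_⊔_; 0ℓ)
open import Algebra.Bundles using (CommutativeMonoid; CommutativeRing)
open import Algebra.Core using (Op₂)
open import Algebra.Morphism.Structures using (module RingMorphisms)
import Algebra.Solver.Ring.NaturalCoefficients.Default as SemiringSolver
open import Algebra.Structures using (IsCommutativeMonoid)
open import Data.Empty using (⊥)
open import Data.Integer.Base as ℤ using (ℤ; +_; -[1+_]; 0ℤ)
import Data.Integer.Properties as ℤ
open import Data.List.Base using (List; []; _∷_; _++_; _∷ʳ_; deduplicate; length; map)
import Data.List.Membership.Setoid as Membership
open import Data.List.Membership.Setoid.Properties
  using (∈-++⁺ˡ; ∈-++⁺ʳ; ∈-deduplicate⁺; ∈-map⁺; ∈-resp-≈)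
open import Data.List.Relation.Unary.All as All using (All; []; _∷_)
open import Data.List.Relation.Unary.AllPairs using ([]; _∷_)
open import Data.List.Relation.Unary.Any using (Any; here; there; any?)
open import Data.List.Relation.Unary.Unique.DecSetoid.Properties using (deduplicate-!)
import Data.List.Relation.Unary.Unique.Setoid as UniqueList
import Data.List.Relation.Unary.Unique.Setoid.Properties as Unique
open import Data.Nat.Base as ℕ using (ℕ)
import Data.Nat.Properties as ℕ
open import Data.Product.Base using (Σ-syntax; ∃-syntax; _×_; _,_; proj₁; proj₂)
open import Data.Rational.Base as ℚ using (ℚ; 0ℚ; 1ℚ; _/_; ↥_; ↧_)
import Data.Rational.Properties as ℚ
open import Data.Rational.Solver using (module +-*-Solver)
open import Data.Rational.Unnormalised.Base as ℚᵘ using (mkℚᵘ)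
import Data.Rational.Unnormalised.Properties as ℚᵘ
open import Data.Sum.Base using (_⊎_; inj₁; inj₂)
open import Function.Base using (_∘_)
open import Relation.Binary.Bundles using (Setoid; DecSetoid)
open import Relation.Binary.Core using (Rel)
open import Relation.Binary.Definitions using (Decidable; _Respects_)
open import Relation.Binary.PropositionalEquality as ≡ using (_≡_; _≢_)
import Relation.Binary.Reasoning.Setoid as SetoidReasoning
open import Relation.Nullary using (¬_; Dec; yes; no; contradiction)
open import Relation.Unary using (Pred; _⊆_)
open import Algebra.Properties.Group ℚ.+-0-group using (⁻¹-involutive)

open +-*-Solver using (solve; _:+_; _:*_; _:-_; :-_; _:=_; con)

-- Eventual properties of sequences, and inequalities between rationals

Eventually : (ℕ → Set) → Set
Eventually P = ∃[ N ] ∀ n → N ℕ.≤ n → P n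

eventually-map : ∀ {P Q : ℕ → Set} → (∀ n → P n → Q n) →
  Eventually P → Eventually Q
eventually-map f (N , p) = N , λ n n≥ → f n (p n n≥)

eventually-zip : ∀ {P Q R : ℕ → Set} → (∀ n → P n → Q n → R n) →
  Eventually P → Eventually Q → Eventually R
eventually-zip f (M , p) (N , q) = M ℕ.⊔ N , λ n n≥ →
  f n (p n (ℕ.m⊔n≤o⇒m≤o M N n≥)) (q n (ℕ.m⊔n≤o⇒n≤o M N n≥))

never : ¬ Eventually (λ _ → ⊥)
never (N , p) = p N ℕ.≤-refl

∣p+q∣< : ∀ {δ ε} p q {r} → δ ℚ.+ δ ≡ ε → p ℚ.+ q ≡ r →
  ℚ.∣ p ∣ ℚ.< δ → ℚ.∣ q ∣ ℚ.< δ → ℚ.∣ r ∣ ℚ.< ε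
∣p+q∣< p q ≡.refl ≡.refl p< q< = ℚ.≤-<-trans (ℚ.∣p+q∣≤∣p∣+∣q∣ p q) (ℚ.+-mono-< p< q<)

-p≤∣p∣ : ∀ p → ℚ.- p ℚ.≤ ℚ.∣ p ∣
-p≤∣p∣ p = ≡.subst (ℚ.- p ℚ.≤_) (ℚ.∣-p∣≡∣p∣ p) (p≤∣p∣ (ℚ.- p))

∣p∣²≡p² : ∀ p → ℚ.∣ p ∣ ℚ.* ℚ.∣ p ∣ ≡ p ℚ.* p
∣p∣²≡p² p with ℚ.∣p∣≡p∨∣p∣≡-p p
... | inj₁ eq rewrite eq = ≡.refl
... | inj₂ eq rewrite eq = solve 1 (λ p → :- p :* :- p := p :* p) ≡.refl p

0≤p² : ∀ p → 0ℚ ℚ.≤ p ℚ.* p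
0≤p² p = ≡.subst (0ℚ ℚ.≤_) (∣p∣²≡p² p)
  (*-mono ℚ.≤-refl (ℚ.0≤∣p∣ p) ℚ.≤-refl (ℚ.0≤∣p∣ p))

square-cancel-< : ∀ {p q} → 0ℚ ℚ.≤ q → p ℚ.* p ℚ.< q ℚ.* q → p ℚ.< q
square-cancel-< {p} {q} 0≤q p²<q² with q ℚ.≤? p
... | no  q≰p = ℚ.≰⇒> q≰p
... | yes q≤p = contradiction
  (ℚ.<-≤-trans p²<q² (*-mono 0≤q q≤p 0≤q q≤p)) (ℚ.<-irrefl ≡.refl)

-- The commutative rings ℝ and ℂ

pointwise : ∀ {x y} → (∀ n → seq x n ≡ seq y n) → x ≈ᴿ y
pointwise {x} {y} eq ε ε>0 = 0 , λ n _ → ≡.subst (λ q → ℚ.∣ q ∣ ℚ.< ε)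
  (≡.sym (≡.trans (≡.cong (ℚ._- seq y n) (eq n)) (ℚ.+-inverseʳ (seq y n)))) ε>0

≈ᴿ-sym : ∀ {x y} → x ≈ᴿ y → y ≈ᴿ x
≈ᴿ-sym {x} {y} x≈y ε ε>0 = eventually-map
  (λ n → ≡.subst (ℚ._< ε) (≡.trans (≡.sym (ℚ.∣-p∣≡∣p∣ (seq x n ℚ.- seq y n)))
    (≡.cong ℚ.∣_∣ (solve 2 (λ p q → :- (p :- q) := q :- p) ≡.refl (seq x n) (seq y n)))))
  (x≈y ε ε>0)

≈ᴿ-trans : ∀ {x y z} → x ≈ᴿ y → y ≈ᴿ z → x ≈ᴿ z
≈ᴿ-trans {x} {y} {z} x≈y y≈z ε ε>0 =
  let δ , δ>0 , 2δ = halve ε>0 in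
  eventually-zip (λ n → ∣p+q∣< (seq x n ℚ.- seq y n) (seq y n ℚ.- seq z n) 2δ
      (solve 3 (λ p q r → (p :- q) :+ (q :- r) := p :- r) ≡.refl
        (seq x n) (seq y n) (seq z n)))
    (x≈y δ δ>0) (y≈z δ δ>0)

+ᴿ-cong : ∀ {x x′ y y′} → x ≈ᴿ x′ → y ≈ᴿ y′ → x +ᴿ y ≈ᴿ x′ +ᴿ y′
+ᴿ-cong {x} {x′} {y} {y′} x≈ y≈ ε ε>0 =
  let δ , δ>0 , 2δ = halve ε>0 in
  eventually-zip (λ n → ∣p+q∣< (seq x n ℚ.- seq x′ n) (seq y n ℚ.- seq y′ n) 2δ
      (solve 4 (λ a b c d → (a :- b) :+ (c :- d) := (a :+ c) :- (b :+ d)) ≡.refl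
        (seq x n) (seq x′ n) (seq y n) (seq y′ n)))
    (x≈ δ δ>0) (y≈ δ δ>0)

-ᴿ-cong : ∀ {x y} → x ≈ᴿ y → -ᴿ x ≈ᴿ -ᴿ y
-ᴿ-cong {x} {y} x≈y ε ε>0 = eventually-map
  (λ n → ≡.subst (λ q → ℚ.∣ q ∣ ℚ.< ε)
    (solve 2 (λ p q → q :- p := :- p :- :- q) ≡.refl (seq x n) (seq y n)))
  (≈ᴿ-sym {x} {y} x≈y ε ε>0)

*ᴿ-cong : ∀ {x x′ y y′} → x ≈ᴿ x′ → y ≈ᴿ y′ → x *ᴿ y ≈ᴿ x′ *ᴿ y′
*ᴿ-cong {x} {x′} {y} {y′} x≈ y≈ ε ε>0 =
  let δ , δ>0 , 2δ = halve ε>0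
      B , B>0 , x-bounded = eventually-bounded {seq x} (cauchy x)
      C , C>0 , y′-bounded = eventually-bounded {seq y′} (cauchy y′)
      η , η>0 , Bη = divide δ>0 B>0
      θ , θ>0 , Cθ = divide δ>0 C>0
  in eventually-zip (λ n → ∣p+q∣<
      (seq x n ℚ.* (seq y n ℚ.- seq y′ n)) (seq y′ n ℚ.* (seq x n ℚ.- seq x′ n)) 2δ
      (solve 4 (λ a b c d → a :* (c :- d) :+ d :* (a :- b) := a :* c :- b :* d) ≡.refl
        (seq x n) (seq x′ n) (seq y n) (seq y′ n)))
    (eventually-zip (λ n x≤ y< →
        ≡.subst (ℚ.∣ seq x n ℚ.* (seq y n ℚ.- seq y′ n) ∣ ℚ.<_) Bη
          (product-bound {seq x n} B>0 x≤ y<))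
      x-bounded (y≈ η η>0))
    (eventually-zip (λ n y≤ x< →
        ≡.subst (ℚ.∣ seq y′ n ℚ.* (seq x n ℚ.- seq x′ n) ∣ ℚ.<_) Cθ
          (product-bound {seq y′ n} C>0 y≤ x<))
      y′-bounded (x≈ θ θ>0))

ℝ-commutativeRing : CommutativeRing 0ℓ 0ℓ
ℝ-commutativeRing = record
  { Carrier = ℝ
  ; _≈_ = _≈ᴿ_
  ; _+_ = _+ᴿ_
  ; _*_ = _*ᴿ_
  ; -_  = -ᴿ_
  ; 0#  = 0ᴿ
  ; 1#  = 1ᴿ
  ; isCommutativeRing = record
    { isRing = record
      { +-isAbelianGroup = record
        { isGroup = record
          { isMonoid = record
            { isSemigroup = record
              { isMagma = record
                { isEquivalence = record
                  { refl  = λ {x} → pointwise {x} {x} λ _ → ≡.refl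
                  ; sym   = λ {x} {y} → ≈ᴿ-sym {x} {y}
                  ; trans = λ {x} {y} {z} → ≈ᴿ-trans {x} {y} {z}
                  }
                ; ∙-cong = λ {x} {x′} {y} {y′} → +ᴿ-cong {x} {x′} {y} {y′}
                }
              ; assoc = λ x y z → pointwise {(x +ᴿ y) +ᴿ z} {x +ᴿ (y +ᴿ z)}
                  λ n → ℚ.+-assoc (seq x n) (seq y n) (seq z n)
              }
            ; identity = (λ x → pointwise {0ᴿ +ᴿ x} {x} λ n → ℚ.+-identityˡ (seq x n))
                       , (λ x → pointwise {x +ᴿ 0ᴿ} {x} λ n → ℚ.+-identityʳ (seq x n))
            }
          ; inverse = (λ x → pointwise { -ᴿ x +ᴿ x} {0ᴿ} λ n → ℚ.+-inverseˡ (seq x n))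
                    , (λ x → pointwise {x +ᴿ -ᴿ x} {0ᴿ} λ n → ℚ.+-inverseʳ (seq x n))
          ; ⁻¹-cong = λ {x} {y} → -ᴿ-cong {x} {y}
          }
        ; comm = λ x y → pointwise {x +ᴿ y} {y +ᴿ x} λ n → ℚ.+-comm (seq x n) (seq y n)
        }
      ; *-cong = λ {x} {x′} {y} {y′} → *ᴿ-cong {x} {x′} {y} {y′}
      ; *-assoc = λ x y z → pointwise {(x *ᴿ y) *ᴿ z} {x *ᴿ (y *ᴿ z)}
          λ n → ℚ.*-assoc (seq x n) (seq y n) (seq z n)
      ; *-identity = (λ x → pointwise {1ᴿ *ᴿ x} {x} λ n → ℚ.*-identityˡ (seq x n))
                   , (λ x → pointwise {x *ᴿ 1ᴿ} {x} λ n → ℚ.*-identityʳ (seq x n))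
      ; distrib = (λ x y z → pointwise {x *ᴿ (y +ᴿ z)} {x *ᴿ y +ᴿ x *ᴿ z}
                    λ n → ℚ.*-distribˡ-+ (seq x n) (seq y n) (seq z n))
                , (λ x y z → pointwise {(y +ᴿ z) *ᴿ x} {y *ᴿ x +ᴿ z *ᴿ x}
                    λ n → ℚ.*-distribʳ-+ (seq x n) (seq y n) (seq z n))
      }
    ; *-comm = λ x y → pointwise {x *ᴿ y} {y *ᴿ x} λ n → ℚ.*-comm (seq x n) (seq y n)
    }
  }

module R = CommutativeRing ℝ-commutativeRing

pointwiseᶜ : ∀ {z w} → (∀ n → seq (re z) n ≡ seq (re w) n) →
  (∀ n → seq (im z) n ≡ seq (im w) n) → z ≈ᶜ w
pointwiseᶜ {z} {w} re≡ im≡ =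
  pointwise {re z} {re w} re≡ , pointwise {im z} {im w} im≡

-ᶜ_ : ℂ → ℂ
-ᶜ z = (-ᴿ re z) +i (-ᴿ im z)

+ᶜ-cong : ∀ {z z′ w w′} → z ≈ᶜ z′ → w ≈ᶜ w′ → z +ᶜ w ≈ᶜ z′ +ᶜ w′
+ᶜ-cong {z} {z′} {w} {w′} (a , b) (c , d) =
  +ᴿ-cong {re z} {re z′} {re w} {re w′} a c , +ᴿ-cong {im z} {im z′} {im w} {im w′} b d

*ᶜ-cong : ∀ {z z′ w w′} → z ≈ᶜ z′ → w ≈ᶜ w′ → z *ᶜ w ≈ᶜ z′ *ᶜ w′
*ᶜ-cong {z} {z′} {w} {w′} (a , b) (c , d) =
    +ᴿ-cong {re z *ᴿ re w} {re z′ *ᴿ re w′} { -ᴿ (im z *ᴿ im w)} { -ᴿ (im z′ *ᴿ im w′)}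
      (*ᴿ-cong {re z} {re z′} {re w} {re w′} a c)
      (-ᴿ-cong {im z *ᴿ im w} {im z′ *ᴿ im w′} (*ᴿ-cong {im z} {im z′} {im w} {im w′} b d))
  , +ᴿ-cong {re z *ᴿ im w} {re z′ *ᴿ im w′} {im z *ᴿ re w} {im z′ *ᴿ re w′}
      (*ᴿ-cong {re z} {re z′} {im w} {im w′} a d)
      (*ᴿ-cong {im z} {im z′} {re w} {re w′} b c)

*ᶜ-assoc : ∀ z w v → (z *ᶜ w) *ᶜ v ≈ᶜ z *ᶜ (w *ᶜ v)
*ᶜ-assoc z w v = pointwiseᶜ {(z *ᶜ w) *ᶜ v} {z *ᶜ (w *ᶜ v)}
  (λ n → solve 6 (λ a b c d e f → (a :* c :- b :* d) :* e :- (a :* d :+ b :* c) :* f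
      := a :* (c :* e :- d :* f) :- b :* (c :* f :+ d :* e)) ≡.refl
    (seq (re z) n) (seq (im z) n) (seq (re w) n) (seq (im w) n) (seq (re v) n) (seq (im v) n))
  (λ n → solve 6 (λ a b c d e f → (a :* c :- b :* d) :* f :+ (a :* d :+ b :* c) :* e
      := a :* (c :* f :+ d :* e) :+ b :* (c :* e :- d :* f)) ≡.refl
    (seq (re z) n) (seq (im z) n) (seq (re w) n) (seq (im w) n) (seq (re v) n) (seq (im v) n))

*ᶜ-comm : ∀ z w → z *ᶜ w ≈ᶜ w *ᶜ z
*ᶜ-comm z w = pointwiseᶜ {z *ᶜ w} {w *ᶜ z}
  (λ n → solve 4 (λ a b c d → a :* c :- b :* d := c :* a :- d :* b) ≡.refl
    (seq (re z) n) (seq (im z) n) (seq (re w) n) (seq (im w) n))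
  (λ n → solve 4 (λ a b c d → a :* d :+ b :* c := c :* b :+ d :* a) ≡.refl
    (seq (re z) n) (seq (im z) n) (seq (re w) n) (seq (im w) n))

*ᶜ-identityˡ : ∀ z → 1ᶜ *ᶜ z ≈ᶜ z
*ᶜ-identityˡ z = pointwiseᶜ {1ᶜ *ᶜ z} {z}
  (λ n → solve 2 (λ a b → con 1ℚ :* a :- con 0ℚ :* b := a) ≡.refl
    (seq (re z) n) (seq (im z) n))
  (λ n → solve 2 (λ a b → con 1ℚ :* b :+ con 0ℚ :* a := b) ≡.refl
    (seq (re z) n) (seq (im z) n))

*ᶜ-distribˡ-+ᶜ : ∀ z w v → z *ᶜ (w +ᶜ v) ≈ᶜ z *ᶜ w +ᶜ z *ᶜ v
*ᶜ-distribˡ-+ᶜ z w v = pointwiseᶜ {z *ᶜ (w +ᶜ v)} {z *ᶜ w +ᶜ z *ᶜ v}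
  (λ n → solve 6 (λ a b c d e f → a :* (c :+ e) :- b :* (d :+ f)
      := (a :* c :- b :* d) :+ (a :* e :- b :* f)) ≡.refl
    (seq (re z) n) (seq (im z) n) (seq (re w) n) (seq (im w) n) (seq (re v) n) (seq (im v) n))
  (λ n → solve 6 (λ a b c d e f → a :* (d :+ f) :+ b :* (c :+ e)
      := (a :* d :+ b :* c) :+ (a :* f :+ b :* e)) ≡.refl
    (seq (re z) n) (seq (im z) n) (seq (re w) n) (seq (im w) n) (seq (re v) n) (seq (im v) n))

≈ᶜ-trans : ∀ {z w v} → z ≈ᶜ w → w ≈ᶜ v → z ≈ᶜ v
≈ᶜ-trans {z} {w} {v} (a , b) (c , d) =
  ≈ᴿ-trans {re z} {re w} {re v} a c , ≈ᴿ-trans {im z} {im w} {im v} b d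

ℂ-commutativeRing : CommutativeRing 0ℓ 0ℓ
ℂ-commutativeRing = record
  { Carrier = ℂ
  ; _≈_ = _≈ᶜ_
  ; _+_ = _+ᶜ_
  ; _*_ = _*ᶜ_
  ; -_  = -ᶜ_
  ; 0#  = 0ᶜ
  ; 1#  = 1ᶜ
  ; isCommutativeRing = record
    { isRing = record
      { +-isAbelianGroup = record
        { isGroup = record
          { isMonoid = record
            { isSemigroup = record
              { isMagma = record
                { isEquivalence = record
                  { refl  = λ {z} → R.refl {re z} , R.refl {im z}
                  ; sym   = λ {z} {w} (a , b) → R.sym {re z} {re w} a , R.sym {im z} {im w} b
                  ; trans = λ {z} {w} {v} → ≈ᶜ-trans {z} {w} {v}
                  }
                ; ∙-cong = λ {z} {z′} {w} {w′} → +ᶜ-cong {z} {z′} {w} {w′}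
                }
              ; assoc = λ z w v →
                  R.+-assoc (re z) (re w) (re v) , R.+-assoc (im z) (im w) (im v)
              }
            ; identity = (λ z → R.+-identityˡ (re z) , R.+-identityˡ (im z))
                       , (λ z → R.+-identityʳ (re z) , R.+-identityʳ (im z))
            }
          ; inverse = (λ z → R.-‿inverseˡ (re z) , R.-‿inverseˡ (im z))
                    , (λ z → R.-‿inverseʳ (re z) , R.-‿inverseʳ (im z))
          ; ⁻¹-cong = λ {z} {w} (a , b) →
              -ᴿ-cong {re z} {re w} a , -ᴿ-cong {im z} {im w} b
          }
        ; comm = λ z w → R.+-comm (re z) (re w) , R.+-comm (im z) (im w)
        }
      ; *-cong = λ {z} {z′} {w} {w′} → *ᶜ-cong {z} {z′} {w} {w′}
      ; *-assoc = *ᶜ-assoc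
      ; *-identity = *ᶜ-identityˡ
          , (λ z → ≈ᶜ-trans {z *ᶜ 1ᶜ} {1ᶜ *ᶜ z} {z} (*ᶜ-comm z 1ᶜ) (*ᶜ-identityˡ z))
      ; distrib = *ᶜ-distribˡ-+ᶜ
          , (λ z w v → ≈ᶜ-trans {(w +ᶜ v) *ᶜ z} {z *ᶜ (w +ᶜ v)} {w *ᶜ z +ᶜ v *ᶜ z}
              (*ᶜ-comm (w +ᶜ v) z)
              (≈ᶜ-trans {z *ᶜ (w +ᶜ v)} {z *ᶜ w +ᶜ z *ᶜ v} {w *ᶜ z +ᶜ v *ᶜ z}
                (*ᶜ-distribˡ-+ᶜ z w v)
                (+ᶜ-cong {z *ᶜ w} {w *ᶜ z} {z *ᶜ v} {v *ᶜ z} (*ᶜ-comm z w) (*ᶜ-comm z v))))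
      }
    ; *-comm = *ᶜ-comm
    }
  }

module C = CommutativeRing ℂ-commutativeRing

-- Distances and square roots

<ᴿ-respˡ-≈ᴿ : ∀ {x y z} → x ≈ᴿ y → x <ᴿ z → y <ᴿ z
<ᴿ-respˡ-≈ᴿ {x} {y} {z} x≈y (ε , ε>0 , x<z) =
  let δ , δ>0 , 2δ = halve ε>0 in
  δ , δ>0 , eventually-zip (λ n y-x< x+ε< → begin-strict
      seq y n ℚ.+ δ
        ≡⟨ solve 3 (λ x y d → y :+ d := x :+ ((y :- x) :+ d)) ≡.refl (seq x n) (seq y n) δ ⟩
      seq x n ℚ.+ ((seq y n ℚ.- seq x n) ℚ.+ δ)
        <⟨ ℚ.+-monoʳ-< (seq x n)
             (ℚ.+-monoˡ-< δ (ℚ.≤-<-trans (p≤∣p∣ (seq y n ℚ.- seq x n)) y-x<)) ⟩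
      seq x n ℚ.+ (δ ℚ.+ δ)
        ≡⟨ ≡.cong (seq x n ℚ.+_) 2δ ⟩
      seq x n ℚ.+ ε
        <⟨ x+ε< ⟩
      seq z n ∎)
    (≈ᴿ-sym {x} {y} x≈y δ δ>0) x<z
  where open ℚ.≤-Reasoning

≈0⇒< : ∀ {x ε} → x ≈ᴿ 0ᴿ → 0ᴿ <ᴿ ε → x <ᴿ ε
≈0⇒< {x} {ε} x≈0 = <ᴿ-respˡ-≈ᴿ {0ᴿ} {x} {ε} (≈ᴿ-sym {x} {0ᴿ} x≈0)

fromℚ-pos : ∀ {p} → 0ℚ ℚ.< p → 0ᴿ <ᴿ fromℚ p
fromℚ-pos {p} p>0 =
  let δ , δ>0 , 2δ = halve p>0 in
  δ , δ>0 , 0 , λ _ _ → ≡.subst (0ℚ ℚ.+ δ ℚ.<_) 2δ (ℚ.+-monoˡ-< δ δ>0)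

∣-∣ᴿ-cong : ∀ {x y} → x ≈ᴿ y → ∣ x ∣ᴿ ≈ᴿ ∣ y ∣ᴿ
∣-∣ᴿ-cong {x} {y} x≈y ε ε>0 = eventually-zip
  (λ n x-y< y-x< → ∣p-q∣<r ℚ.∣ seq x n ∣ ℚ.∣ seq y n ∣
    (ℚ.≤-<-trans (reverse-triangle (seq x n) (seq y n)) x-y<)
    (ℚ.≤-<-trans (reverse-triangle (seq y n) (seq x n)) y-x<))
  (x≈y ε ε>0) (≈ᴿ-sym {x} {y} x≈y ε ε>0)
  where
  reverse-triangle : ∀ p q → ℚ.∣ p ∣ ℚ.- ℚ.∣ q ∣ ℚ.≤ ℚ.∣ p ℚ.- q ∣
  reverse-triangle p q = begin
    ℚ.∣ p ∣ ℚ.- ℚ.∣ q ∣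
      ≡⟨ ≡.cong (λ r → ℚ.∣ r ∣ ℚ.- ℚ.∣ q ∣) (solve 2 (λ p q → p := (p :- q) :+ q) ≡.refl p q) ⟩
    ℚ.∣ (p ℚ.- q) ℚ.+ q ∣ ℚ.- ℚ.∣ q ∣
      ≤⟨ ℚ.+-monoˡ-≤ (ℚ.- ℚ.∣ q ∣) (ℚ.∣p+q∣≤∣p∣+∣q∣ (p ℚ.- q) q) ⟩
    (ℚ.∣ p ℚ.- q ∣ ℚ.+ ℚ.∣ q ∣) ℚ.- ℚ.∣ q ∣
      ≡⟨ solve 2 (λ a b → (a :+ b) :- b := a) ≡.refl ℚ.∣ p ℚ.- q ∣ ℚ.∣ q ∣ ⟩
    ℚ.∣ p ℚ.- q ∣ ∎
    where open ℚ.≤-Reasoning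

distᴿ-respˡ : ∀ {x y z ε} → x ≈ᴿ y → distᴿ x z <ᴿ ε → distᴿ y z <ᴿ ε
distᴿ-respˡ {x} {y} {z} {ε} x≈y = <ᴿ-respˡ-≈ᴿ {distᴿ x z} {distᴿ y z} {ε}
  (∣-∣ᴿ-cong {x -ᴿ z} {y -ᴿ z} (R.+-congʳ { -ᴿ z} {x} {y} x≈y))

distᴿ-≈ : ∀ {x y ε} → x ≈ᴿ y → 0ᴿ <ᴿ ε → distᴿ x y <ᴿ ε
distᴿ-≈ {x} {y} {ε} x≈y = ≈0⇒< {distᴿ x y} {ε}
  (∣-∣ᴿ-cong {x -ᴿ y} {0ᴿ}
    (R.trans {x -ᴿ y} {y -ᴿ y} {0ᴿ} (R.+-congʳ { -ᴿ y} {x} {y} x≈y) (R.-‿inverseʳ y)))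

-- This follows from the uniform continuity that makes the square root of a Cauchy
-- sequence Cauchy.
√-cong : ∀ {x y} → x ≈ᴿ y → √ x ≈ᴿ √ y
√-cong {x} {y} x≈y ε ε>0 =
  let δ , δ>0 , 2δ = halve ε>0 in
  eventually-zip
    (λ n h< (x-y< , y-x<) → ∣p-q∣<r (approx√ n (seq x n)) (approx√ n (seq y n))
      (≡.subst (approx√ n (seq x n) ℚ.- approx√ n (seq y n) ℚ.<_) 2δ
        (approx√-close {δ} {seq x n} {seq y n} n n δ>0 h< x-y<))
      (≡.subst (approx√ n (seq y n) ℚ.- approx√ n (seq x n) ℚ.<_) 2δ
        (approx√-close {δ} {seq y n} {seq x n} n n δ>0 h< y-x<)))
    (mesh-small δ>0)
    (eventually-zip (λ _ → _,_)
      (x≈y (δ ℚ.* δ) (0<* δ>0 δ>0)) (≈ᴿ-sym {x} {y} x≈y (δ ℚ.* δ) (0<* δ>0 δ>0)))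

-- Here a is √ q rounded down to a grid, as approx√-lower describes it.
lower-root-small : ∀ {a q ε} → 0ℚ ℚ.< ε → 0ℚ ℚ.≤ a →
  a ≡ 0ℚ ⊎ a ℚ.* a ℚ.≤ q → ℚ.∣ q ℚ.- 0ℚ ∣ ℚ.< ε ℚ.* ε → ℚ.∣ a ℚ.- 0ℚ ∣ ℚ.< ε
lower-root-small {a} {q} {ε} ε>0 0≤a lower q<ε² =
  ≡.subst (ℚ._< ε) (≡.sym (≡.trans (≡.cong ℚ.∣_∣ (ℚ.+-identityʳ a)) (ℚ.0≤p⇒∣p∣≡p 0≤a))) (a<ε lower)
  where
  a<ε : a ≡ 0ℚ ⊎ a ℚ.* a ℚ.≤ q → a ℚ.< ε
  a<ε (inj₁ a≡0)  = ≡.subst (ℚ._< ε) (≡.sym a≡0) ε>0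
  a<ε (inj₂ a²≤q) = square-cancel-< (ℚ.<⇒≤ ε>0) (ℚ.≤-<-trans a²≤q
    (ℚ.≤-<-trans (p≤∣p∣ q) (≡.subst (λ r → ℚ.∣ r ∣ ℚ.< ε ℚ.* ε) (ℚ.+-identityʳ q) q<ε²)))

√-≈0 : ∀ {x} → x ≈ᴿ 0ᴿ → √ x ≈ᴿ 0ᴿ
√-≈0 {x} x≈0 ε ε>0 = eventually-map
  (λ n → lower-root-small {approx√ n (seq x n)} {seq x n} {ε}
    ε>0 (0≤grid (sqrtIndex n (seq x n)) n) (approx√-lower n (seq x n)))
  (x≈0 (ε ℚ.* ε) (0<* ε>0 ε>0))

∣-∣²-cong : ∀ {z w} → z ≈ᶜ w → ∣ z ∣² ≈ᴿ ∣ w ∣²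
∣-∣²-cong {z} {w} (a , b) =
  +ᴿ-cong {re z *ᴿ re z} {re w *ᴿ re w} {im z *ᴿ im z} {im w *ᴿ im w}
    (*ᴿ-cong {re z} {re w} {re z} {re w} a a) (*ᴿ-cong {im z} {im w} {im z} {im w} b b)

∣-∣ᶜ-cong : ∀ {z w} → z ≈ᶜ w → ∣ z ∣ᶜ ≈ᴿ ∣ w ∣ᶜ
∣-∣ᶜ-cong {z} {w} z≈w = √-cong {∣ z ∣²} {∣ w ∣²} (∣-∣²-cong {z} {w} z≈w)

∣0∣²≈0 : ∣ 0ᶜ ∣² ≈ᴿ 0ᴿ
∣0∣²≈0 = pointwise {∣ 0ᶜ ∣²} {0ᴿ} λ _ → ≡.refl

≈0⇒∣-∣²≈0 : ∀ {z} → z ≈ᶜ 0ᶜ → ∣ z ∣² ≈ᴿ 0ᴿ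
≈0⇒∣-∣²≈0 {z} z≈0 =
  R.trans {∣ z ∣²} {∣ 0ᶜ ∣²} {0ᴿ} (∣-∣²-cong {z} {0ᶜ} z≈0) ∣0∣²≈0

≈0⇒∣-∣ᶜ≈0 : ∀ {z} → z ≈ᶜ 0ᶜ → ∣ z ∣ᶜ ≈ᴿ 0ᴿ
≈0⇒∣-∣ᶜ≈0 {z} z≈0 = √-≈0 {∣ z ∣²} (≈0⇒∣-∣²≈0 {z} z≈0)

distᶜ-respˡ : ∀ {z w v ε} → z ≈ᶜ w → distᶜ z v <ᴿ ε → distᶜ w v <ᴿ ε
distᶜ-respˡ {z} {w} {v} {ε} z≈w = <ᴿ-respˡ-≈ᴿ {distᶜ z v} {distᶜ w v} {ε}
  (∣-∣ᶜ-cong {z -ᶜ v} {w -ᶜ v} (C.+-congʳ { -ᶜ v} {z} {w} z≈w))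

distᶜ-≈ : ∀ {z w ε} → z ≈ᶜ w → 0ᴿ <ᴿ ε → distᶜ z w <ᴿ ε
distᶜ-≈ {z} {w} {ε} z≈w = ≈0⇒< {distᶜ z w} {ε} (≈0⇒∣-∣ᶜ≈0 {z -ᶜ w}
  (C.trans {z -ᶜ w} {w -ᶜ w} {0ᶜ} (C.+-congʳ { -ᶜ w} {z} {w} z≈w) (C.-‿inverseʳ w)))

-- Here a is √ q rounded down to a grid of mesh h, as approx√-upper describes it.
upper-root-bound : ∀ {a h q x γ δ} → 0ℚ ℚ.≤ a → 0ℚ ℚ.< h → 0ℚ ℚ.< γ →
  q ℚ.< (a ℚ.+ h) ℚ.* (a ℚ.+ h) → a ℚ.+ γ ℚ.< δ → h ℚ.< δ → x ℚ.* x ℚ.≤ q →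
  ℚ.∣ x ∣ ℚ.< δ ℚ.+ δ
upper-root-bound {a} {h} {q} {x} {γ} {δ} 0≤a h>0 γ>0 upper a+γ<δ h<δ x²≤q = begin-strict
  ℚ.∣ x ∣      <⟨ square-cancel-< (0≤+ 0≤a (ℚ.<⇒≤ h>0)) ∣x∣²<[a+h]² ⟩
  a ℚ.+ h      <⟨ ℚ.+-mono-< a<δ h<δ ⟩
  δ ℚ.+ δ      ∎
  where
  open ℚ.≤-Reasoning
  ∣x∣²<[a+h]² : ℚ.∣ x ∣ ℚ.* ℚ.∣ x ∣ ℚ.< (a ℚ.+ h) ℚ.* (a ℚ.+ h)
  ∣x∣²<[a+h]² = begin-strict
    ℚ.∣ x ∣ ℚ.* ℚ.∣ x ∣        ≡⟨ ∣p∣²≡p² x ⟩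
    x ℚ.* x                    ≤⟨ x²≤q ⟩
    q                          <⟨ upper ⟩
    (a ℚ.+ h) ℚ.* (a ℚ.+ h)    ∎
  a<δ : a ℚ.< δ
  a<δ = begin-strict
    a            ≡⟨ ≡.sym (ℚ.+-identityʳ a) ⟩
    a ℚ.+ 0ℚ     <⟨ ℚ.+-monoʳ-< a γ>0 ⟩
    a ℚ.+ γ      <⟨ a+γ<δ ⟩
    δ            ∎

-- If √ x is smaller than every positive real, then a sequence y with y² ≤ x
-- tends to 0.
√-separated : ∀ {x} (y : ℕ → ℚ) → (∀ n → y n ℚ.* y n ℚ.≤ seq x n) →
  (∀ ε → 0ᴿ <ᴿ ε → √ x <ᴿ ε) →
  ∀ ε → 0ℚ ℚ.< ε → Eventually (λ n → ℚ.∣ y n ∣ ℚ.< ε)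
√-separated {x} y y²≤x small ε ε>0 =
  let δ , δ>0 , 2δ = halve ε>0
      γ , γ>0 , √x<δ = small (fromℚ δ) (fromℚ-pos δ>0)
  in eventually-zip (λ n h<δ √x+γ<δ → ≡.subst (ℚ.∣ y n ∣ ℚ.<_) 2δ
      (upper-root-bound {approx√ n (seq x n)} {_} {seq x n} {y n} {γ} {δ}
        (0≤grid (sqrtIndex n (seq x n)) n) (0<mesh n) γ>0
        (approx√-upper n (seq x n)) √x+γ<δ h<δ (y²≤x n)))
    (mesh-small δ>0) √x<δ

-- The squares of the differences of the real and of the imaginary parts are at most
-- the square of the distance.
distᶜ-separated : ∀ {z w} → (∀ ε → 0ᴿ <ᴿ ε → distᶜ z w <ᴿ ε) → z ≈ᶜ w
distᶜ-separated {z} {w} small =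
    √-separated {∣ z -ᶜ w ∣²} r (λ n → ≡.subst (ℚ._≤ r n ℚ.* r n ℚ.+ i n ℚ.* i n)
      (ℚ.+-identityʳ (r n ℚ.* r n)) (ℚ.+-monoʳ-≤ (r n ℚ.* r n) (0≤p² (i n)))) small
  , √-separated {∣ z -ᶜ w ∣²} i (λ n → ≡.subst (ℚ._≤ r n ℚ.* r n ℚ.+ i n ℚ.* i n)
      (ℚ.+-identityˡ (i n ℚ.* i n)) (ℚ.+-monoˡ-≤ (i n ℚ.* i n) (0≤p² (r n)))) small
  where
  r i : ℕ → ℚ
  r n = seq (re z) n ℚ.- seq (re w) n
  i n = seq (im z) n ℚ.- seq (im w) n

distᴿ-separated : ∀ {x y} → (∀ ε → 0ᴿ <ᴿ ε → distᴿ x y <ᴿ ε) → x ≈ᴿ y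
distᴿ-separated {x} {y} small ε ε>0 =
  let γ , γ>0 , close = small (fromℚ ε) (fromℚ-pos ε>0)
      d = λ n → ℚ.∣ seq x n ℚ.- seq y n ∣
  in eventually-map (λ n → ℚ.≤-<-trans (≡.subst (ℚ._≤ d n ℚ.+ γ) (ℚ.+-identityʳ (d n))
      (ℚ.+-monoʳ-≤ (d n) (ℚ.<⇒≤ γ>0)))) close

-- If a is within η of a nonnegative q, then a + 2η ≥ η.
shift-up : ∀ {η q} a → 0ℚ ℚ.≤ q → ℚ.∣ a ℚ.- q ∣ ℚ.< η →
  ¬ ℚ.∣ (a ℚ.+ (η ℚ.+ η)) ℚ.- 0ℚ ∣ ℚ.< η
shift-up {η} {q} a 0≤q a-q<η a+2η<η = ℚ.<-irrefl ≡.refl (begin-strict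
  η
    ≡⟨ solve 1 (λ e → e := con 0ℚ :+ ((e :+ e) :- e)) ≡.refl η ⟩
  0ℚ ℚ.+ ((η ℚ.+ η) ℚ.- η)
    ≤⟨ ℚ.+-monoˡ-≤ ((η ℚ.+ η) ℚ.- η) 0≤q ⟩
  q ℚ.+ ((η ℚ.+ η) ℚ.- η)
    <⟨ ℚ.+-monoʳ-< q (ℚ.+-monoʳ-< (η ℚ.+ η)
         (ℚ.neg-antimono-< (ℚ.≤-<-trans (-p≤∣p∣ (a ℚ.- q)) a-q<η))) ⟩
  q ℚ.+ ((η ℚ.+ η) ℚ.- ℚ.- (a ℚ.- q))
    ≡⟨ solve 3 (λ q d x → q :+ (d :- :- (x :- q)) := (x :+ d) :- con 0ℚ) ≡.refl q (η ℚ.+ η) a ⟩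
  (a ℚ.+ (η ℚ.+ η)) ℚ.- 0ℚ
    ≤⟨ p≤∣p∣ ((a ℚ.+ (η ℚ.+ η)) ℚ.- 0ℚ) ⟩
  ℚ.∣ (a ℚ.+ (η ℚ.+ η)) ℚ.- 0ℚ ∣
    <⟨ a+2η<η ⟩
  η ∎)
  where open ℚ.≤-Reasoning

shift-down : ∀ {η q} a → q ℚ.≤ 0ℚ → ℚ.∣ a ℚ.- q ∣ ℚ.< η →
  ¬ ℚ.∣ (a ℚ.- (η ℚ.+ η)) ℚ.- 0ℚ ∣ ℚ.< η
shift-down {η} {q} a q≤0 a-q<η a-2η<η = shift-up {η} {ℚ.- q} (ℚ.- a)
  (ℚ.neg-antimono-≤ q≤0)
  (∣-∣< (solve 2 (λ a q → :- (a :- q) := :- a :- :- q) ≡.refl a q) a-q<η)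
  (∣-∣< (solve 2 (λ a d → :- ((a :- d) :- con 0ℚ) := (:- a :+ d) :- con 0ℚ) ≡.refl
    a (η ℚ.+ η)) a-2η<η)
  where
  ∣-∣< : ∀ {p r} → ℚ.- p ≡ r → ℚ.∣ p ∣ ℚ.< η → ℚ.∣ r ∣ ℚ.< η
  ∣-∣< {p} ≡.refl = ≡.subst (ℚ._< η) (≡.sym (ℚ.∣-p∣≡∣p∣ p))

-- The sign of t is that of a rational approximation q of x, which moves x away
-- from 0; only the square of t matters for the norm.
perturb : ∀ x {δ} → 0ℚ ℚ.< δ →
  ∃[ t ] t ℚ.* t ≡ δ ℚ.* δ × ¬ (x +ᴿ fromℚ t ≈ᴿ 0ᴿ)
perturb x {δ} δ>0 =
  let η , η>0 , 2η = halve δ>0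
      N , close = cauchy x η η>0
  in by-sign η η>0 2η (seq x N) (N , λ n n≥ → close n N n≥ ℕ.≤-refl)
  where
  by-sign : ∀ η → 0ℚ ℚ.< η → η ℚ.+ η ≡ δ → ∀ q →
    Eventually (λ n → ℚ.∣ seq x n ℚ.- q ∣ ℚ.< η) →
    ∃[ t ] t ℚ.* t ≡ δ ℚ.* δ × ¬ (x +ᴿ fromℚ t ≈ᴿ 0ᴿ)
  by-sign η η>0 ≡.refl q near with ℚ.≤-total 0ℚ q
  ... | inj₁ 0≤q = δ , ≡.refl , λ x+δ≈0 → never
    (eventually-zip (λ n → shift-up {η} {q} (seq x n) 0≤q) near (x+δ≈0 η η>0))
  ... | inj₂ q≤0 = ℚ.- δ , solve 1 (λ d → :- d :* :- d := d :* d) ≡.refl δ ,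
    λ x-δ≈0 → never
    (eventually-zip (λ n → shift-down {η} {q} (seq x n) q≤0) near (x-δ≈0 η η>0))

-- Unconditional sums of finitely supported functions

-- The setting covers the real and the complex sums.  It is given by raw operations,
-- with the laws apart, so that HasSum below is literally the predicate used for ℝ
-- and ℂ.
module FiniteSums {a ℓ} {A : Set a} (_≈_ : Rel A ℓ) (_∙_ : Op₂ A) (ε : A)
  (isCommutativeMonoid : IsCommutativeMonoid _≈_ _∙_ ε)
  (dist : A → A → ℝ)
  (dist-≈ : ∀ {x y δ} → x ≈ y → 0ᴿ <ᴿ δ → dist x y <ᴿ δ)
  (dist-respˡ : ∀ {x y z δ} → x ≈ y → dist x z <ᴿ δ → dist y z <ᴿ δ)
  (dist-separated : ∀ {x y} → (∀ δ → 0ᴿ <ᴿ δ → dist x y <ᴿ δ) → x ≈ y)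
  {c ℓ′} (I : Setoid c ℓ′) where

  private
    M : CommutativeMonoid a ℓ
    M = record { isCommutativeMonoid = isCommutativeMonoid }

    module M = CommutativeMonoid M

  open M using (∙-cong; ∙-congˡ; ∙-congʳ)
  open Setoid I using () renaming (Carrier to Index; _≈_ to _≋_)
  open Membership I using (_∈_; _∉_)
  open UniqueList I using (Unique)
  open Summation _∙_ ε dist I
  open SetoidReasoning M.setoid

  Congruent : (Index → A) → Set _
  Congruent f = ∀ {i j} → i ≋ j → f i ≈ f j

  -- Functions vanishing outside S.
  SupportedOn : (Index → A) → List Index → Set _
  SupportedOn f S = ∀ {i} → i ∉ S → f i ≈ ε

  sum-cong : ∀ {f g} S → (∀ {i} → i ∈ S → f i ≈ g i) → finiteSum f S ≈ finiteSum g S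
  sum-cong []      f≈g = M.refl
  sum-cong (i ∷ S) f≈g =
    ∙-cong (f≈g (here (Setoid.refl I))) (sum-cong S (f≈g ∘ there))

  sum-zero : ∀ {f} S → (∀ {i} → i ∈ S → f i ≈ ε) → finiteSum f S ≈ ε
  sum-zero []      f≈0 = M.refl
  sum-zero (i ∷ S) f≈0 = M.trans
    (∙-cong (f≈0 (here (Setoid.refl I))) (sum-zero S (f≈0 ∘ there))) (M.identityˡ ε)

  sum-∙ : ∀ f g S → finiteSum (λ i → f i ∙ g i) S ≈ (finiteSum f S ∙ finiteSum g S)
  sum-∙ f g []      = M.sym (M.identityˡ ε)
  sum-∙ f g (i ∷ S) = begin
    (f i ∙ g i) ∙ finiteSum _ S                        ≈⟨ ∙-congˡ (sum-∙ f g S) ⟩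
    (f i ∙ g i) ∙ (finiteSum f S ∙ finiteSum g S)      ≈⟨ interchange _ _ _ _ ⟩
    (f i ∙ finiteSum f S) ∙ (g i ∙ finiteSum g S)      ∎
    where open import Algebra.Properties.CommutativeSemigroup M.commutativeSemigroup using (interchange)

  -- S without the occurrence of i that p points at.
  delete : ∀ {i} S → i ∈ S → List Index
  delete (_ ∷ S) (here _)  = S
  delete (j ∷ S) (there p) = j ∷ delete S p

  sum-delete : ∀ {f i S} → Congruent f → (p : i ∈ S) →
    finiteSum f S ≈ (f i ∙ finiteSum f (delete S p))
  sum-delete f-cong (here i≋j)  = ∙-congʳ (f-cong (Setoid.sym I i≋j))
  sum-delete {f} {i} {j ∷ S} f-cong (there p) = begin
    f j ∙ finiteSum f S                          ≈⟨ ∙-congˡ (sum-delete f-cong p) ⟩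
    f j ∙ (f i ∙ finiteSum f (delete S p))       ≈⟨ x∙yz≈y∙xz _ _ _ ⟩
    f i ∙ (f j ∙ finiteSum f (delete S p))       ∎
    where open import Algebra.Properties.CommutativeSemigroup M.commutativeSemigroup using (x∙yz≈y∙xz)

  ∈-delete⁺ : ∀ {i j S} (p : i ∈ S) → ¬ (i ≋ j) → j ∈ S → j ∈ delete S p
  ∈-delete⁺ (here i≋k)  i≉j (here j≋k)  =
    contradiction (Setoid.trans I i≋k (Setoid.sym I j≋k)) i≉j
  ∈-delete⁺ (here i≋k)  i≉j (there q)   = q
  ∈-delete⁺ (there p)   i≉j (here j≋k)  = here j≋k
  ∈-delete⁺ (there p)   i≉j (there q)   = there (∈-delete⁺ p i≉j q)

  ∈-delete⁻ : ∀ {i j S} (p : i ∈ S) → j ∈ delete S p → j ∈ S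
  ∈-delete⁻ (here _)  q          = there q
  ∈-delete⁻ (there p) (here j≋k) = here j≋k
  ∈-delete⁻ (there p) (there q)  = there (∈-delete⁻ p q)

  lookup-≉ : ∀ {i j S} → All (λ k → ¬ (i ≋ k)) S → j ∈ S → ¬ (i ≋ j)
  lookup-≉ (i≉k ∷ _) (here j≋k) i≋j = i≉k (Setoid.trans I i≋j j≋k)
  lookup-≉ (_ ∷ i≉)  (there q)      = lookup-≉ i≉ q

  ∉-delete : ∀ {i j S} → Unique S → (p : i ∈ S) → j ∈ delete S p → ¬ (i ≋ j)
  ∉-delete (k≉ ∷ _) (here i≋k) q i≋j =
    lookup-≉ k≉ q (Setoid.trans I (Setoid.sym I i≋k) i≋j)
  ∉-delete (k≉ ∷ _) (there p) (here j≋k) i≋j =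
    lookup-≉ k≉ p (Setoid.sym I (Setoid.trans I i≋j j≋k))
  ∉-delete (_ ∷ u) (there p) (there q) = ∉-delete u p q

  delete-unique : ∀ {i S} → Unique S → (p : i ∈ S) → Unique (delete S p)
  delete-unique (_ ∷ u)  (here _)  = u
  delete-unique (k≉ ∷ u) (there p) = All-delete k≉ p ∷ delete-unique u p
    where
    All-delete : ∀ {P : Index → Set _} {i S} → All P S → (p : i ∈ S) → All P (delete S p)
    All-delete (_ ∷ ps)  (here _)  = ps
    All-delete (px ∷ ps) (there p) = px ∷ All-delete ps p

  -- Adding indices where f vanishes to a duplicate-free list does not change the
  -- sum, whatever the order.
  sum-⊇ : ∀ {f} → Congruent f → ∀ {S T} → Unique S → Unique T →
    (∀ {i} → i ∈ S → i ∈ T) → (∀ {i} → i ∈ T → i ∉ S → f i ≈ ε) →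
    finiteSum f T ≈ finiteSum f S
  sum-⊇ f-cong {[]} {T} _ _ _ f≈0 = sum-zero T (λ i∈T → f≈0 i∈T λ ())
  sum-⊇ {f} f-cong {i ∷ S} {T} (i≉ ∷ uS) uT S⊆T f≈0 = begin
    finiteSum f T                        ≈⟨ sum-delete f-cong i∈T ⟩
    f i ∙ finiteSum f (delete T i∈T)     ≈⟨ ∙-congˡ (sum-⊇ f-cong uS (delete-unique uT i∈T)
      (λ j∈S → ∈-delete⁺ i∈T (lookup-≉ i≉ j∈S) (S⊆T (there j∈S)))
      (λ j∈T′ j∉S → f≈0 (∈-delete⁻ i∈T j∈T′) λ where
        (here j≋i)  → ∉-delete uT i∈T j∈T′ (Setoid.sym I j≋i)
        (there j∈S) → j∉S j∈S)) ⟩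
    f i ∙ finiteSum f S                  ∎
    where i∈T = S⊆T (here (Setoid.refl I))

  sum-supported : ∀ {f} → Congruent f → ∀ {S T} → Unique S → Unique T →
    (∀ {i} → i ∈ S → i ∈ T) → SupportedOn f S → finiteSum f T ≈ finiteSum f S
  sum-supported f-cong uS uT S⊆T f≈0 = sum-⊇ f-cong uS uT S⊆T (λ _ → f≈0)

  HasSum-finite : ∀ {f S s} → Congruent f → Unique S → SupportedOn f S →
    finiteSum f S ≈ s → HasSum f s
  HasSum-finite {f} {S} f-cong uS f≈0 sum≈s δ δ>0 = S , λ T uT S⊆T →
    dist-≈ {δ = δ} (M.trans (sum-supported {f} f-cong uS uT S⊆T f≈0) sum≈s) δ>0

  -- A duplicate-free list containing two given lists.
  enlarge : Decidable _≋_ → ∀ S₀ S → ∃[ T ] Unique T ×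
    (∀ {i} → i ∈ S₀ → i ∈ T) × (∀ {i} → i ∈ S → i ∈ T)
  enlarge _≟_ S₀ S = deduplicate _≟_ (S₀ ++ S) , deduplicate-! DI (S₀ ++ S)
    , ∈-dedup ∘ ∈-++⁺ˡ I , ∈-dedup ∘ ∈-++⁺ʳ I S₀
    where
    DI : DecSetoid _ _
    DI = record { isDecEquivalence = record { isEquivalence = Setoid.isEquivalence I ; _≟_ = _≟_ } }
    ∈-dedup : ∀ {i} → i ∈ S₀ ++ S → i ∈ deduplicate _≟_ (S₀ ++ S)
    ∈-dedup = ∈-deduplicate⁺ I _≟_ (λ j≋i k≋i → Setoid.trans I k≋i (Setoid.sym I j≋i))

  -- The sum of a finitely supported function is only its finite sum.
  HasSum-unique : Decidable _≋_ → ∀ {f s S} → Congruent f → Unique S → SupportedOn f S →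
    HasSum f s → finiteSum f S ≈ s
  HasSum-unique _≟_ {f} {s} {S} f-cong uS f≈0 sum = dist-separated λ δ δ>0 →
    let S₀ , close = sum δ δ>0
        T , uT , S₀⊆T , S⊆T = enlarge _≟_ S₀ S
    in dist-respˡ {δ = δ} (sum-supported {f} f-cong uS uT S⊆T f≈0) (close T uT S₀⊆T)

module _ {c ℓ} (I : Setoid c ℓ) where

  module Sumᴿ = FiniteSums _≈ᴿ_ _+ᴿ_ 0ᴿ R.+-isCommutativeMonoid distᴿ
    (λ {x} {y} {ε} → distᴿ-≈ {x} {y} {ε}) (λ {x} {y} {z} {ε} → distᴿ-respˡ {x} {y} {z} {ε})
    (λ {x} {y} → distᴿ-separated {x} {y}) I
  module Sumᶜ = FiniteSums _≈ᶜ_ _+ᶜ_ 0ᶜ C.+-isCommutativeMonoid distᶜ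
    (λ {x} {y} {ε} → distᶜ-≈ {x} {y} {ε}) (λ {x} {y} {z} {ε} → distᶜ-respˡ {x} {y} {z} {ε})
    (λ {x} {y} → distᶜ-separated {x} {y}) I

  open UniqueList I using (Unique)

  -- Changing a summable function on a finite set.
  HasSumᴿ-+finite : ∀ f g h S {s} →
    Sumᴿ.Congruent h → Unique S → Sumᴿ.SupportedOn h S → (∀ i → g i ≈ᴿ f i +ᴿ h i) →
    HasSumᴿ I f s → HasSumᴿ I g (s +ᴿ finiteSumᴿ I h S)
  HasSumᴿ-+finite f g h S {s} h-cong uS h≈0 g≈f+h sum ε ε>0 =
    let S₀ , close = sum ε ε>0 in
    S₀ ++ S , λ T uT ⊆T → <ᴿ-respˡ-≈ᴿ
      {distᴿ (Σ f T) s} {distᴿ (Σ g T) (s +ᴿ Σ h S)} {ε}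
      (∣-∣ᴿ-cong {Σ f T -ᴿ s} {Σ g T -ᴿ (s +ᴿ Σ h S)} (difference T
        (Sumᴿ.sum-supported {h} h-cong uS uT (⊆T ∘ ∈-++⁺ʳ I S₀) h≈0)))
      (close T uT (⊆T ∘ ∈-++⁺ˡ I))
    where
    Σ = finiteSumᴿ I
    open SetoidReasoning R.setoid
    difference : ∀ T → Σ h T ≈ᴿ Σ h S → Σ f T -ᴿ s ≈ᴿ Σ g T -ᴿ (s +ᴿ Σ h S)
    difference T h≈ = begin
      Σ f T -ᴿ s
        ≈⟨ pointwise {Σ f T -ᴿ s} {(Σ f T +ᴿ Σ h S) -ᴿ (s +ᴿ Σ h S)} (λ n →
             solve 3 (λ a b c → a :- b := (a :+ c) :- (b :+ c)) ≡.refl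
               (seq (Σ f T) n) (seq s n) (seq (Σ h S) n)) ⟩
      (Σ f T +ᴿ Σ h S) -ᴿ (s +ᴿ Σ h S)
        ≈⟨ R.+-congʳ { -ᴿ (s +ᴿ Σ h S)} {Σ f T +ᴿ Σ h S} {Σ g T} (begin
             Σ f T +ᴿ Σ h S    ≈⟨ R.+-congˡ {Σ f T} {Σ h T} {Σ h S} h≈ ⟨
             Σ f T +ᴿ Σ h T    ≈⟨ Sumᴿ.sum-∙ f h T ⟨
             Σ (λ i → f i +ᴿ h i) T ≈⟨ Sumᴿ.sum-cong {g} {λ i → f i +ᴿ h i} T (λ {i} _ → g≈f+h i) ⟨
             Σ g T             ∎) ⟩
      Σ g T -ᴿ (s +ᴿ Σ h S) ∎

  sumᶜ-* : ∀ k f S → finiteSumᶜ I (λ i → k *ᶜ f i) S ≈ᶜ k *ᶜ finiteSumᶜ I f S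
  sumᶜ-* k f []      = C.sym {k *ᶜ 0ᶜ} {0ᶜ} (C.zeroʳ k)
  sumᶜ-* k f (i ∷ S) = begin
    k *ᶜ f i +ᶜ finiteSumᶜ I (λ i → k *ᶜ f i) S
      ≈⟨ C.+-congˡ {k *ᶜ f i} {finiteSumᶜ I (λ i → k *ᶜ f i) S} {k *ᶜ finiteSumᶜ I f S}
           (sumᶜ-* k f S) ⟩
    k *ᶜ f i +ᶜ k *ᶜ finiteSumᶜ I f S
      ≈⟨ C.distribˡ k (f i) (finiteSumᶜ I f S) ⟨
    k *ᶜ (f i +ᶜ finiteSumᶜ I f S) ∎
    where open SetoidReasoning C.setoid

  HasSumᶜ-single : ∀ f i {s} → Sumᶜ.Congruent f → Sumᶜ.SupportedOn f (i ∷ []) →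
    f i ≈ᶜ s → HasSumᶜ I f s
  HasSumᶜ-single f i {s} f-cong f≈0 fi≈s = Sumᶜ.HasSum-finite {f} {i ∷ []} {s}
    (λ {i} {j} → f-cong {i} {j}) ([] ∷ []) (λ {j} → f≈0 {j})
    (C.trans {f i +ᶜ 0ᶜ} {f i} {s} (C.+-identityʳ (f i)) fi≈s)

  AbsSummable-single : ∀ f i → Sumᶜ.Congruent f → Sumᶜ.SupportedOn f (i ∷ []) →
    AbsSummable I f
  AbsSummable-single f i f-cong f≈0 = finiteSumᴿ I (λ j → ∣ f j ∣ᶜ) (i ∷ [])
    , Sumᴿ.HasSum-finite {λ j → ∣ f j ∣ᶜ} {i ∷ []} {finiteSumᴿ I (λ j → ∣ f j ∣ᶜ) (i ∷ [])}
      (λ {j} {k} j≈k → ∣-∣ᶜ-cong {f j} {f k} (f-cong {j} {k} j≈k))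
      ([] ∷ []) (λ {j} j∉ → ≈0⇒∣-∣ᶜ≈0 {f j} (f≈0 {j} j∉))
      (R.refl {finiteSumᴿ I (λ j → ∣ f j ∣ᶜ) (i ∷ [])})

-- Integers among the rationals

*-/1 : ∀ m n → (m ℤ.* n) / 1 ≡ (m / 1) ℚ.* (n / 1)
*-/1 m n = ℚ.toℚᵘ-injective (ℚᵘ.≃-trans (/-toℚᵘ (m ℤ.* n) 0) (ℚᵘ.≃-sym
  (ℚᵘ.≃-trans (ℚ.toℚᵘ-homo-* (m / 1) (n / 1))
    (ℚᵘ.*-cong {_} {mkℚᵘ m 0} {_} {mkℚᵘ n 0} (/-toℚᵘ m 0) (/-toℚᵘ n 0)))))

neg-/1 : ∀ n → (ℤ.- n) / 1 ≡ ℚ.- (n / 1)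
neg-/1 (+ ℕ.zero)  = ≡.refl
neg-/1 (+ ℕ.suc n) = ≡.refl
neg-/1 -[1+ n ]    = ≡.sym (⁻¹-involutive (+ ℕ.suc n / 1))

/1-injective-0 : ∀ {n} → n / 1 ≡ 0ℚ → n ≡ 0ℤ
/1-injective-0 {n} n/1≡0
  with ℚᵘ.≃-trans (ℚᵘ.≃-sym (/-toℚᵘ n 0)) (ℚᵘ.≃-reflexive (≡.cong ℚ.toℚᵘ n/1≡0))
... | ℚᵘ.*≡* eq = ≡.trans (≡.sym (ℤ.*-identityʳ n)) eq

-- A rational times its denominator is its numerator.
↥≡↧* : ∀ q → (↥ q) / 1 ≡ (↧ q / 1) ℚ.* q
↥≡↧* q@(ℚ.mkℚ n d _) = ℚ.toℚᵘ-injective (ℚᵘ.≃-trans (/-toℚᵘ n 0) (ℚᵘ.≃-sym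
  (ℚᵘ.≃-trans (ℚ.toℚᵘ-homo-* (↧ q / 1) q)
    (ℚᵘ.≃-trans (ℚᵘ.*-congʳ {ℚ.toℚᵘ q} (/-toℚᵘ (↧ q) 0))
      (ℚᵘ.*≡* (≡.trans (ℤ.*-identityʳ (↧ q ℤ.* n)) (≡.trans (ℤ.*-comm (↧ q) n)
        (≡.cong (λ m → n ℤ.* + ℕ.suc m) (≡.sym (ℕ.+-identityʳ d))))))))))

-- Algebraic number fields

module NumberField {c ℓ₁ ℓ₂} (K : AlgebraicNumberField c ℓ₁ ℓ₂) where

  open AlgebraicNumberField K
  open CommutativeRing commutativeRing using (commutativeSemiring; ring)
  open RingMorphisms.IsRingHomomorphism ι-hom
    using (⟦⟧-cong; 0#-homo; 1#-homo; *-homo; -‿homo)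
  open SemiringSolver commutativeSemiring using ()
    renaming (solve to solve-K; _:+_ to _⊕_; _:*_ to _⊛_; _:=_ to _⊜_; con to κ)
  open import Algebra.Properties.Ring ring using (-0#≈0#)
  open SetoidReasoning setoid

  eval : List ℚ → Carrier → Carrier
  eval = evalPoly commutativeRing ι

  eval-cong : ∀ p {x y} → x ≈ y → eval p x ≈ eval p y
  eval-cong []      x≈y = refl
  eval-cong (a ∷ p) x≈y = +-congˡ (*-cong x≈y (eval-cong p x≈y))

  IsUnit : Carrier → Set _
  IsUnit x = ∃[ y ] x * y ≈ 1#

  IsUnit-cong : ∀ {x y} → x ≈ y → IsUnit x → IsUnit y
  IsUnit-cong x≈y (z , xz≈1) = z , trans (*-congʳ (sym x≈y)) xz≈1

  *-unit : ∀ {x y} → IsUnit x → IsUnit y → IsUnit (x * y)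
  *-unit {x} {y} (x⁻¹ , xx⁻¹) (y⁻¹ , yy⁻¹) = x⁻¹ * y⁻¹ , (begin
    x * y * (x⁻¹ * y⁻¹)     ≈⟨ solve-K 4 (λ a b c d → a ⊛ b ⊛ (c ⊛ d) ⊜ (a ⊛ c) ⊛ (b ⊛ d)) refl x y x⁻¹ y⁻¹ ⟩
    (x * x⁻¹) * (y * y⁻¹)   ≈⟨ *-cong xx⁻¹ yy⁻¹ ⟩
    1# * 1#                 ≈⟨ *-identityˡ 1# ⟩
    1#                      ∎)

  unit-factorˡ : ∀ {x y} → IsUnit (x * y) → IsUnit x
  unit-factorˡ {x} {y} (z , xyz≈1) = y * z , trans (sym (*-assoc x y z)) xyz≈1

  unit-cancel : ∀ {x y} → IsUnit y → x * y ≈ 0# → x ≈ 0#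
  unit-cancel {x} {y} (z , yz≈1) xy≈0 = begin
    x             ≈⟨ *-identityʳ x ⟨
    x * 1#        ≈⟨ *-congˡ yz≈1 ⟨
    x * (y * z)   ≈⟨ *-assoc x y z ⟨
    x * y * z     ≈⟨ *-congʳ xy≈0 ⟩
    0# * z        ≈⟨ zeroˡ z ⟩
    0#            ∎

  x-0≈x : ∀ x → x - 0# ≈ x
  x-0≈x x = trans (+-congˡ -0#≈0#) (+-identityʳ x)

  #0⇒unit : ∀ {x} → x # 0# → IsUnit x
  #0⇒unit {x} x#0 = let y , _ , [x-0]y≈1 = #⇒invertible x#0 in
    IsUnit-cong (x-0≈x x) (y , [x-0]y≈1)

  unit⇒#0 : ∀ {x} → IsUnit x → x # 0#
  unit⇒#0 {x} (y , xy≈1) = invertible⇒#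
    (y , trans (*-comm y (x - 0#)) [x-0]y≈1 , [x-0]y≈1)
    where [x-0]y≈1 = trans (*-congʳ (x-0≈x x)) xy≈1

  unit≉0 : ∀ {x} → IsUnit x → ¬ (x ≈ 0#)
  unit≉0 u x≈0 = #-irrefl x≈0 (unit⇒#0 u)

  -- K is a local ring: a unit x + y is apart from 0, so by cotransitivity x is apart
  -- from 0 or from x + y.
  unit-summand : ∀ x y → IsUnit (x + y) → IsUnit x ⊎ IsUnit y
  unit-summand x y u with #-cotrans (unit⇒#0 u) x
  ... | inj₂ x#0   = inj₁ (#0⇒unit x#0)
  ... | inj₁ x+y#x = let z , _ , [x+y-x]z≈1 = #⇒invertible x+y#x in
    inj₂ (IsUnit-cong x+y-x≈y (z , [x+y-x]z≈1))
    where
    x+y-x≈y : x + y - x ≈ y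
    x+y-x≈y = begin
      x + y - x       ≈⟨ +-congʳ (+-comm x y) ⟩
      y + x - x       ≈⟨ +-assoc y x (- x) ⟩
      y + (x - x)     ≈⟨ +-congˡ (-‿inverseʳ x) ⟩
      y + 0#          ≈⟨ +-identityʳ y ⟩
      y               ∎

  ι-unit : ∀ {q} → q ≢ 0ℚ → IsUnit (ι q)
  ι-unit {q} q≢0 = ι (ℚ.1/ q) ,
    trans (sym (*-homo q (ℚ.1/ q))) (trans (⟦⟧-cong (ℚ.*-inverseʳ q)) 1#-homo)
    where instance _ = ℚ.≢-nonZero q≢0

  -- Decidability of equality

  -- For p = X^k q with q(0) ≠ 0, the second alternative arises when q(x) is a
  -- unit: then p(x) = x^k q(x) is a unit as soon as x is.  At the first nonzero
  -- coefficient a, the unit a is the sum of the value at x and - x r.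
  unit-or-eval-unit : ∀ {p} x → Any (_≢ 0ℚ) p →
    IsUnit x ⊎ (IsUnit x → IsUnit (eval p x))
  unit-or-eval-unit {a ∷ p} x nz with a ℚ.≟ 0ℚ
  unit-or-eval-unit {a ∷ p} x (here a≢0)  | yes a≡0 = contradiction a≡0 a≢0
  unit-or-eval-unit {a ∷ p} x (there nz) | yes a≡0 with unit-or-eval-unit x nz
  ... | inj₁ u = inj₁ u
  ... | inj₂ f = inj₂ λ u → IsUnit-cong
    (sym (trans (+-congʳ (trans (⟦⟧-cong a≡0) 0#-homo)) (+-identityˡ _))) (*-unit u (f u))
  unit-or-eval-unit {a ∷ p} x nz | no a≢0
    with unit-summand (eval (a ∷ p) x) (- (x * eval p x)) (IsUnit-cong (sym a+xr-xr≈a) (ι-unit a≢0))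
    where
    a+xr-xr≈a : eval (a ∷ p) x - x * eval p x ≈ ι a
    a+xr-xr≈a = trans (+-assoc _ _ _) (trans (+-congˡ (-‿inverseʳ _)) (+-identityʳ _))
  ... | inj₁ u = inj₂ λ _ → u
  ... | inj₂ (y , -xry≈1) = inj₁ (unit-factorˡ (- y , (begin
    x * eval p x * - y      ≈⟨ -‿distribʳ-* _ _ ⟨
    - (x * eval p x * y)    ≈⟨ -‿distribˡ-* _ _ ⟩
    - (x * eval p x) * y    ≈⟨ -xry≈1 ⟩
    1#                      ∎)))
    where open import Algebra.Properties.Ring ring using (-‿distribˡ-*; -‿distribʳ-*)

  ≈0? : ∀ x → Dec (x ≈ 0#)
  ≈0? x with algebraic x
  ... | p , nz , px≈0 with unit-or-eval-unit x nz
  ... | inj₁ u = no (unit≉0 u)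
  ... | inj₂ f = yes (proj₁ (tight x 0#) λ x#0 → unit≉0 (f (#0⇒unit x#0)) px≈0)

  infix 4 _≟_
  _≟_ : Decidable _≈_
  x ≟ y with ≈0? (x - y)
  ... | yes x-y≈0 = yes (x∙y⁻¹≈ε⇒x≈y x y x-y≈0)
    where open import Algebra.Properties.Group (CommutativeRing.+-group commutativeRing) using (x∙y⁻¹≈ε⇒x≈y)
  ... | no  x-y≉0 = no λ x≈y → x-y≉0 (trans (+-congʳ x≈y) (-‿inverseʳ y))

  -- Denominators

  -- The image of an integer in K.
  ⟦_⟧ : ℤ → Carrier
  ⟦ n ⟧ = ι (n / 1)

  ⟦⟧-* : ∀ m n → ⟦ m ℤ.* n ⟧ ≈ ⟦ m ⟧ * ⟦ n ⟧
  ⟦⟧-* m n = trans (⟦⟧-cong (*-/1 m n)) (*-homo (m / 1) (n / 1))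

  ⟦⟧-unit : ∀ {n} → n ≢ 0ℤ → IsUnit ⟦ n ⟧
  ⟦⟧-unit n≢0 = ι-unit (n≢0 ∘ /1-injective-0)

  -- The value at x of the polynomial with integer coefficients as followed by
  -- the rational leading coefficient c.
  value : List ℤ → ℚ → Carrier → Carrier
  value as c = eval (map (_/ 1) as ∷ʳ c)

  -- x is a root of an integer polynomial with leading coefficient c.  The value
  -- c = 0 is not excluded here.
  IsDenominator : ℤ → Carrier → Set _
  IsDenominator c x = Σ[ as ∈ List ℤ ] value as (c / 1) x ≈ 0#

  value-* : ∀ m as c x → value (map (m ℤ.*_) as) ((m ℤ.* c) / 1) x ≈ ⟦ m ⟧ * value as (c / 1) x
  value-* m [] c x = begin
    ⟦ m ℤ.* c ⟧ + x * 0#       ≈⟨ +-congʳ (⟦⟧-* m c) ⟩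
    ⟦ m ⟧ * ⟦ c ⟧ + x * 0#     ≈⟨ solve-K 3 (λ m c x → m ⊛ c ⊕ x ⊛ κ 0 ⊜ m ⊛ (c ⊕ x ⊛ κ 0)) refl ⟦ m ⟧ ⟦ c ⟧ x ⟩
    ⟦ m ⟧ * (⟦ c ⟧ + x * 0#)   ∎
  value-* m (a ∷ as) c x = begin
    ⟦ m ℤ.* a ⟧ + x * value (map (m ℤ.*_) as) ((m ℤ.* c) / 1) x
      ≈⟨ +-cong (⟦⟧-* m a) (*-congˡ (value-* m as c x)) ⟩
    ⟦ m ⟧ * ⟦ a ⟧ + x * (⟦ m ⟧ * value as (c / 1) x)
      ≈⟨ solve-K 4 (λ m a x v → m ⊛ a ⊕ x ⊛ (m ⊛ v) ⊜ m ⊛ (a ⊕ x ⊛ v)) refl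
           ⟦ m ⟧ ⟦ a ⟧ x (value as (c / 1) x) ⟩
    ⟦ m ⟧ * (⟦ a ⟧ + x * value as (c / 1) x) ∎

  denominator-*ˡ : ∀ m {c x} → IsDenominator c x → IsDenominator (m ℤ.* c) x
  denominator-*ˡ m {c} {x} (as , v≈0) =
    map (m ℤ.*_) as , trans (value-* m as c x) (trans (*-congˡ v≈0) (zeroʳ ⟦ m ⟧))

  -- The coefficients below the leading 1 of the monic polynomial q with
  -- q(c x) = c^(n-1) p(x), for p with leading coefficient c and degree n.
  monic : ℤ → List ℤ → List ℤ
  monic c []       = []
  monic c (a ∷ as) = a ℤ.* c ℤ.^ length as ∷ monic c as

  -- Both sides are multiplied by c to avoid the exponent n - 1, which makes no
  -- sense for n = 0.
  value-monic : ∀ c as x →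
    value (monic c as) 1ℚ (⟦ c ⟧ * x) * ⟦ c ⟧ ≈ ⟦ c ℤ.^ length as ⟧ * value as (c / 1) x
  value-monic c [] x = begin
    (ι 1ℚ + ⟦ c ⟧ * x * 0#) * ⟦ c ⟧
      ≈⟨ solve-K 3 (λ i c x → (i ⊕ c ⊛ x ⊛ κ 0) ⊛ c ⊜ i ⊛ (c ⊕ x ⊛ κ 0)) refl (ι 1ℚ) ⟦ c ⟧ x ⟩
    ι 1ℚ * (⟦ c ⟧ + x * 0#) ∎
  value-monic c (a ∷ as) x = begin
    (⟦ a ℤ.* c ℤ.^ length as ⟧ + ⟦ c ⟧ * x * V) * ⟦ c ⟧
      ≈⟨ *-congʳ (+-congʳ (⟦⟧-* a (c ℤ.^ length as))) ⟩
    (⟦ a ⟧ * C + ⟦ c ⟧ * x * V) * ⟦ c ⟧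
      ≈⟨ solve-K 5 (λ a C c x V → (a ⊛ C ⊕ c ⊛ x ⊛ V) ⊛ c ⊜ a ⊛ C ⊛ c ⊕ c ⊛ x ⊛ (V ⊛ c)) refl
           ⟦ a ⟧ C ⟦ c ⟧ x V ⟩
    ⟦ a ⟧ * C * ⟦ c ⟧ + ⟦ c ⟧ * x * (V * ⟦ c ⟧)
      ≈⟨ +-congˡ (*-congˡ (value-monic c as x)) ⟩
    ⟦ a ⟧ * C * ⟦ c ⟧ + ⟦ c ⟧ * x * (C * v)
      ≈⟨ solve-K 5 (λ a C c x v → a ⊛ C ⊛ c ⊕ c ⊛ x ⊛ (C ⊛ v) ⊜ c ⊛ C ⊛ (a ⊕ x ⊛ v)) refl
           ⟦ a ⟧ C ⟦ c ⟧ x v ⟩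
    ⟦ c ⟧ * C * (⟦ a ⟧ + x * v)
      ≈⟨ *-congʳ (⟦⟧-* c (c ℤ.^ length as)) ⟨
    ⟦ c ℤ.* c ℤ.^ length as ⟧ * (⟦ a ⟧ + x * v) ∎
    where
    C = ⟦ c ℤ.^ length as ⟧
    V = value (monic c as) 1ℚ (⟦ c ⟧ * x)
    v = value as (c / 1) x

  denominator⇒integral : ∀ {c x} → c ≢ 0ℤ → IsDenominator c x → IsIntegral (⟦ c ⟧ * x)
  denominator⇒integral {c} {x} c≢0 (as , v≈0) = monic c as ,
    unit-cancel (⟦⟧-unit c≢0) (trans (value-monic c as x) (trans (*-congˡ v≈0) (zeroʳ _)))

  IsIntegral-cong : ∀ {x y} → x ≈ y → IsIntegral x → IsIntegral y
  IsIntegral-cong x≈y (p , px≈0) =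
    p , trans (eval-cong (map (_/ 1) p ∷ʳ 1ℚ) (sym x≈y)) px≈0

  integer-integral : ∀ n → IsIntegral ⟦ n ⟧
  integer-integral n = (ℤ.- n) ∷ [] , (begin
    ⟦ ℤ.- n ⟧ + ⟦ n ⟧ * (ι 1ℚ + ⟦ n ⟧ * 0#)
      ≈⟨ +-cong (trans (⟦⟧-cong (neg-/1 n)) (-‿homo (n / 1)))
           (*-congˡ (+-cong 1#-homo (zeroʳ ⟦ n ⟧))) ⟩
    - ⟦ n ⟧ + ⟦ n ⟧ * (1# + 0#)
      ≈⟨ +-congˡ (trans (*-congˡ (+-identityʳ 1#)) (*-identityʳ ⟦ n ⟧)) ⟩
    - ⟦ n ⟧ + ⟦ n ⟧
      ≈⟨ -‿inverseˡ ⟦ n ⟧ ⟩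
    0# ∎)

  eval-zero : ∀ {p} x → All (_≡ 0ℚ) p → eval p x ≈ 0#
  eval-zero x []          = refl
  eval-zero x (a≡0 ∷ p≡0) = trans
    (+-cong (trans (⟦⟧-cong a≡0) 0#-homo) (trans (*-congˡ (eval-zero x p≡0)) (zeroʳ x)))
    (+-identityˡ 0#)

  -- Trailing zero coefficients are dropped on the way, so that the leading
  -- coefficient c is nonzero.
  clear-denominators : ∀ p → All (_≡ 0ℚ) p ⊎
    (∃[ as ] ∃[ c ] ∃[ k ] c ≢ 0ℤ × (∀ x → value as (c / 1) x ≈ ⟦ k ⟧ * eval p x))
  clear-denominators [] = inj₁ []
  clear-denominators (q ∷ p) with clear-denominators p
  ... | inj₂ (as , c , k , c≢0 , v≈) = inj₂
    (k ℤ.* ↥ q ∷ map (↧ q ℤ.*_) as , ↧ q ℤ.* c , k ℤ.* ↧ q , ↧c≢0 , λ x → begin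
      ⟦ k ℤ.* ↥ q ⟧ + x * value (map (↧ q ℤ.*_) as) ((↧ q ℤ.* c) / 1) x
        ≈⟨ +-cong (⟦⟧-* k (↥ q)) (*-congˡ (trans (value-* (↧ q) as c x) (*-congˡ (v≈ x)))) ⟩
      ⟦ k ⟧ * ⟦ ↥ q ⟧ + x * (⟦ ↧ q ⟧ * (⟦ k ⟧ * eval p x))
        ≈⟨ +-congʳ (*-congˡ ⟦↥⟧≈) ⟩
      ⟦ k ⟧ * (⟦ ↧ q ⟧ * ι q) + x * (⟦ ↧ q ⟧ * (⟦ k ⟧ * eval p x))
        ≈⟨ solve-K 5 (λ k d q x v → k ⊛ (d ⊛ q) ⊕ x ⊛ (d ⊛ (k ⊛ v)) ⊜ k ⊛ d ⊛ (q ⊕ x ⊛ v)) refl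
             ⟦ k ⟧ ⟦ ↧ q ⟧ (ι q) x (eval p x) ⟩
      ⟦ k ⟧ * ⟦ ↧ q ⟧ * (ι q + x * eval p x)
        ≈⟨ *-congʳ (⟦⟧-* k (↧ q)) ⟨
      ⟦ k ℤ.* ↧ q ⟧ * (ι q + x * eval p x) ∎)
    where
    ↧c≢0 : ↧ q ℤ.* c ≢ 0ℤ
    ↧c≢0 eq with ℤ.i*j≡0⇒i≡0∨j≡0 (↧ q) eq
    ... | inj₂ c≡0 = c≢0 c≡0
    ⟦↥⟧≈ : ⟦ ↥ q ⟧ ≈ ⟦ ↧ q ⟧ * ι q
    ⟦↥⟧≈ = trans (⟦⟧-cong (↥≡↧* q)) (*-homo (↧ q / 1) q)
  ... | inj₁ p≡0 with q ℚ.≟ 0ℚ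
  ... | yes q≡0 = inj₁ (q≡0 ∷ p≡0)
  ... | no  q≢0 = inj₂ ([] , ↥ q , ↧ q , q≢0 ∘ ℚ.↥p≡0⇒p≡0 q , λ x → begin
      ⟦ ↥ q ⟧ + x * 0#
        ≈⟨ +-cong (trans (⟦⟧-cong (↥≡↧* q)) (*-homo (↧ q / 1) q)) (zeroʳ x) ⟩
      ⟦ ↧ q ⟧ * ι q + 0#
        ≈⟨ solve-K 2 (λ d q → d ⊛ q ⊕ κ 0 ⊜ d ⊛ (q ⊕ κ 0)) refl ⟦ ↧ q ⟧ (ι q) ⟩
      ⟦ ↧ q ⟧ * (ι q + 0#)
        ≈⟨ *-congˡ (+-congˡ (trans (*-congˡ (eval-zero x p≡0)) (zeroʳ x))) ⟨
      ⟦ ↧ q ⟧ * (ι q + x * eval p x) ∎)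

  has-denominator : ∀ x → ∃[ c ] c ≢ 0ℤ × IsDenominator c x
  has-denominator x with algebraic x
  ... | p , nz , px≈0 with clear-denominators p
  ... | inj₁ p≡0 = contradiction nz (λ nz → All.lookupAny p≡0 nz .proj₂ (All.lookupAny p≡0 nz .proj₁))
  ... | inj₂ (as , c , k , c≢0 , v≈) =
    c , c≢0 , as , trans (v≈ x) (trans (*-congˡ px≈0) (zeroʳ ⟦ k ⟧))

  common-denominator : ∀ S → ∃[ c ] c ≢ 0ℤ × All (IsDenominator c) S
  common-denominator []      = + 1 , (λ ()) , []
  common-denominator (x ∷ S) =
    let m , m≢0 , m-den = has-denominator x
        n , n≢0 , n-den = common-denominator S
    in m ℤ.* n
     , (λ mn≡0 → ≢0 m≢0 n≢0 (ℤ.i*j≡0⇒i≡0∨j≡0 m mn≡0))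
     , ≡.subst (λ c → IsDenominator c x) (ℤ.*-comm n m) (denominator-*ˡ n m-den)
     ∷ All.map (denominator-*ˡ m) n-den
    where
    ≢0 : ∀ {m n} → m ≢ 0ℤ → n ≢ 0ℤ → ¬ (m ≡ 0ℤ ⊎ n ≡ 0ℤ)
    ≢0 m≢0 n≢0 (inj₁ m≡0) = m≢0 m≡0
    ≢0 m≢0 n≢0 (inj₂ n≡0) = n≢0 n≡0

-- Finitely supported elements and density

-- Here s is the square of the norm of F, Φ the part of it carried by the finite set,
-- d² the square of the change at 0, and 2d a lower bound for the radius ε.  In
-- fact s + d² - Φ < 2d² < 4d² < ε².
truncation-estimate : ∀ {s Φ ε d} → 0ℚ ℚ.< d →
  Eventually (λ n → d ℚ.+ d ℚ.< seq ε n) → distᴿ Φ s <ᴿ fromℚ (d ℚ.* d) →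
  s +ᴿ (fromℚ (d ℚ.* d) -ᴿ Φ) <ᴿ ε *ᴿ ε
truncation-estimate {s} {Φ} {ε} {d} d>0 2d<ε (γ , γ>0 , close) =
  γ , γ>0 , eventually-zip (λ n → bound (seq s n) (seq Φ n) (seq ε n)) 2d<ε close
  where
  open ℚ.≤-Reasoning
  bound : ∀ s Φ ε → d ℚ.+ d ℚ.< ε → ℚ.∣ Φ ℚ.- s ∣ ℚ.+ γ ℚ.< d ℚ.* d →
    s ℚ.+ (d ℚ.* d ℚ.- Φ) ℚ.+ γ ℚ.< ε ℚ.* ε
  bound s Φ ε 2d<ε close = begin-strict
    s ℚ.+ (d ℚ.* d ℚ.- Φ) ℚ.+ γ
      ≡⟨ solve 4 (λ s Φ D γ → s :+ (D :- Φ) :+ γ := (D :+ γ) :+ (con 0ℚ :- (Φ :- s))) ≡.refl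
           s Φ (d ℚ.* d) γ ⟩
    (d ℚ.* d ℚ.+ γ) ℚ.+ (0ℚ ℚ.- (Φ ℚ.- s))
      ≡⟨ ≡.cong ((d ℚ.* d ℚ.+ γ) ℚ.+_) (ℚ.+-identityˡ (ℚ.- (Φ ℚ.- s))) ⟩
    (d ℚ.* d ℚ.+ γ) ℚ.+ ℚ.- (Φ ℚ.- s)
      ≤⟨ ℚ.+-monoʳ-≤ (d ℚ.* d ℚ.+ γ) (-p≤∣p∣ (Φ ℚ.- s)) ⟩
    (d ℚ.* d ℚ.+ γ) ℚ.+ ℚ.∣ Φ ℚ.- s ∣
      ≡⟨ solve 3 (λ D γ x → (D :+ γ) :+ x := D :+ (x :+ γ)) ≡.refl (d ℚ.* d) γ ℚ.∣ Φ ℚ.- s ∣ ⟩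
    d ℚ.* d ℚ.+ (ℚ.∣ Φ ℚ.- s ∣ ℚ.+ γ)
      <⟨ ℚ.+-monoʳ-< (d ℚ.* d) close ⟩
    d ℚ.* d ℚ.+ d ℚ.* d
      ≡⟨ ℚ.+-identityʳ _ ⟨
    (d ℚ.* d ℚ.+ d ℚ.* d) ℚ.+ 0ℚ
      ≤⟨ ℚ.+-monoʳ-≤ (d ℚ.* d ℚ.+ d ℚ.* d) (0≤+ (0≤p² d) (0≤p² d)) ⟩
    (d ℚ.* d ℚ.+ d ℚ.* d) ℚ.+ (d ℚ.* d ℚ.+ d ℚ.* d)
      ≡⟨ solve 1 (λ d → (d :* d :+ d :* d) :+ (d :* d :+ d :* d) := (d :+ d) :* (d :+ d)) ≡.refl d ⟩
    (d ℚ.+ d) ℚ.* (d ℚ.+ d)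
      ≤⟨ *-mono 0≤2d (ℚ.≤-refl {d ℚ.+ d}) 0≤2d (ℚ.<⇒≤ 2d<ε) ⟩
    (d ℚ.+ d) ℚ.* ε
      <⟨ ℚ.*-monoˡ-<-pos ε {{ℚ.positive (ℚ.≤-<-trans 0≤2d 2d<ε)}} 2d<ε ⟩
    ε ℚ.* ε ∎
    where
    0≤2d : 0ℚ ℚ.≤ d ℚ.+ d
    0≤2d = 0≤+ (ℚ.<⇒≤ d>0) (ℚ.<⇒≤ d>0)

module Density {c ℓ₁ ℓ₂} (K : AlgebraicNumberField c ℓ₁ ℓ₂) where

  open AlgebraicNumberField K
    using ( Carrier; _≈_; _*_; 0#; 1#; setoid; IsIntegral
          ; *-congˡ; *-congʳ; *-assoc; *-comm; *-identityˡ)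
  module K = AlgebraicNumberField K
  open NumberField K
  open GradedHolomorphic K
  open Membership setoid using (_∈_)
  open UniqueList setoid using (Unique)
  module Σᴿ = Sumᴿ setoid
  module Σᶜ = Sumᶜ setoid

  sumᴿ : (Carrier → ℝ) → List Carrier → ℝ
  sumᴿ = finiteSumᴿ setoid
  sumᶜ : (Carrier → ℂ) → List Carrier → ℂ
  sumᶜ = finiteSumᶜ setoid

  -- A finitely supported function as an element of H.
  polynomial : ∀ f S → Σᶜ.Congruent f → Unique S → Σᶜ.SupportedOn f S → H
  polynomial f S f-cong uS f≈0 = record
    { coeff      = f
    ; coeff-cong = f-cong
    ; coeff-ℓ²   = sumᴿ (λ α → ∣ f α ∣²) S , Σᴿ.HasSum-finite
        {λ α → ∣ f α ∣²} {S} {sumᴿ (λ α → ∣ f α ∣²) S}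
        (λ {α} {β} α≈β → ∣-∣²-cong {f α} {f β} (f-cong α≈β)) uS
        (λ {α} α∉S → ≈0⇒∣-∣²≈0 {f α} (f≈0 α∉S)) (R.refl {sumᴿ (λ α → ∣ f α ∣²) S})
    }

  -- Classes of finitely supported elements whose coefficients have nonzero sum.
  P : Pred ℙH (c ⊔ ℓ₁)
  P F = ∃[ S ] Unique S × Σᶜ.SupportedOn (coeff (rep F)) S ×
    ¬ (sumᶜ (coeff (rep F)) S ≈ᶜ 0ᶜ)

  sum≉0⇒¬I : ∀ F {S} → Unique S → Σᶜ.SupportedOn (coeff F) S →
    ¬ (sumᶜ (coeff F) S ≈ᶜ 0ᶜ) → ¬ I F
  sum≉0⇒¬I F {S} uS F≈0 sum≉0 (_ , sum≈0) =
    sum≉0 (Σᶜ.HasSum-unique _≟_ {coeff F} {0ᶜ} {S} (coeff-cong F) uS F≈0 sum≈0)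

  -- An element is nonzero if its coefficients have nonzero sum.
  toℙ : ∀ F S → ¬ (sumᶜ (coeff F) S ≈ᶜ 0ᶜ) → ℙH
  toℙ F S sum≉0 = record
    { rep     = F
    ; nonzero = λ F≈0 → sum≉0 (Σᶜ.sum-zero {coeff F} S λ {α} _ → F≈0 α)
    }

  P⊆N : P ⊆ N
  P⊆N {F} (S , uS , F≈0 , sum≉0) = sum≉0⇒¬I (rep F) uS F≈0 sum≉0

  P-respects-∼ : P Respects _∼_
  P-respects-∼ {F} {G} (k , (w , kw≈1) , F≈kG) (S , uS , F≈0 , sum≉0) =
    S , uS , G≈0 , λ sumG≈0 → sum≉0 (begin
      sumᶜ f S                    ≈⟨ Σᶜ.sum-cong {f} {λ α → k *ᶜ g α} S (λ {α} _ → F≈kG α) ⟩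
      sumᶜ (λ α → k *ᶜ g α) S     ≈⟨ sumᶜ-* setoid k g S ⟩
      k *ᶜ sumᶜ g S               ≈⟨ C.*-congˡ {k} {sumᶜ g S} {0ᶜ} sumG≈0 ⟩
      k *ᶜ 0ᶜ                     ≈⟨ C.zeroʳ k ⟩
      0ᶜ                          ∎)
    where
    f = coeff (rep F)
    g = coeff (rep G)
    open SetoidReasoning C.setoid
    G≈0 : Σᶜ.SupportedOn g S
    G≈0 {α} α∉S = begin
      g α                  ≈⟨ C.*-identityˡ (g α) ⟨
      1ᶜ *ᶜ g α            ≈⟨ C.*-congʳ {g α} {k *ᶜ w} {1ᶜ} kw≈1 ⟨
      k *ᶜ w *ᶜ g α        ≈⟨ C.*-congʳ {g α} {k *ᶜ w} {w *ᶜ k} (C.*-comm k w) ⟩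
      w *ᶜ k *ᶜ g α        ≈⟨ C.*-assoc w k (g α) ⟩
      w *ᶜ (k *ᶜ g α)      ≈⟨ C.*-congˡ {w} {f α} {k *ᶜ g α} (F≈kG α) ⟨
      w *ᶜ f α             ≈⟨ C.*-congˡ {w} {f α} {0ᶜ} (F≈0 α∉S) ⟩
      w *ᶜ 0ᶜ              ≈⟨ C.zeroʳ w ⟩
      0ᶜ                   ∎

  abstract

    -- The coefficients of z ϱ^β.
    monomial : ℂ → Carrier → Carrier → ℂ
    monomial z β α with α ≟ β
    ... | yes _ = z
    ... | no  _ = 0ᶜ

    monomial-≈ : ∀ z {α β} → α ≈ β → monomial z β α ≈ᶜ z
    monomial-≈ z {α} {β} α≈β with α ≟ β
    ... | yes _   = C.refl {z}
    ... | no  α≉β = contradiction α≈β α≉β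

    monomial-≉ : ∀ z {α β} → ¬ (α ≈ β) → monomial z β α ≈ᶜ 0ᶜ
    monomial-≉ z {α} {β} α≉β with α ≟ β
    ... | yes α≈β = contradiction α≈β α≉β
    ... | no  _   = C.refl {0ᶜ}

  monomial-cong : ∀ z β → Σᶜ.Congruent (monomial z β)
  monomial-cong z β {α} {α′} α≈α′ = by-cases (α′ ≟ β)
    where
    by-cases : Dec (α′ ≈ β) → monomial z β α ≈ᶜ monomial z β α′
    by-cases (yes α′≈β) = C.trans {monomial z β α} {z} {monomial z β α′}
      (monomial-≈ z (K.trans α≈α′ α′≈β))
      (C.sym {monomial z β α′} {z} (monomial-≈ z α′≈β))
    by-cases (no α′≉β) = C.trans {monomial z β α} {0ᶜ} {monomial z β α′}
      (monomial-≉ z (α′≉β ∘ K.trans (K.sym α≈α′)))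
      (C.sym {monomial z β α′} {0ᶜ} (monomial-≉ z α′≉β))

  monomial-supported : ∀ z β → Σᶜ.SupportedOn (monomial z β) (β ∷ [])
  monomial-supported z β α∉ = monomial-≉ z (α∉ ∘ here)

  singleton-unique : ∀ β → Unique (β ∷ [])
  singleton-unique β = [] ∷ []

  _∈?_ : ∀ α S → Dec (α ∈ S)
  α ∈? S = any? (α ≟_) S

  abstract

    -- f on S, and 0 elsewhere.
    restrict : (Carrier → ℂ) → List Carrier → Carrier → ℂ
    restrict f S α with α ∈? S
    ... | yes _ = f α
    ... | no  _ = 0ᶜ

    restrict-∈ : ∀ f S {α} → α ∈ S → restrict f S α ≈ᶜ f α
    restrict-∈ f S {α} α∈S with α ∈? S
    ... | yes _   = C.refl {f α}
    ... | no  α∉S = contradiction α∈S α∉S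

    restrict-∉ : ∀ f S → Σᶜ.SupportedOn (restrict f S) S
    restrict-∉ f S {α} α∉S with α ∈? S
    ... | yes α∈S = contradiction α∈S α∉S
    ... | no  _   = C.refl {0ᶜ}

  restrict-cong : ∀ f S → Σᶜ.Congruent f → Σᶜ.Congruent (restrict f S)
  restrict-cong f S f-cong {α} {β} α≈β = by-cases (β ∈? S)
    where
    by-cases : Dec (β ∈ S) → restrict f S α ≈ᶜ restrict f S β
    by-cases (yes β∈S) = C.trans {restrict f S α} {f α} {restrict f S β}
      (restrict-∈ f S (∈-resp-≈ setoid (K.sym α≈β) β∈S))
      (C.trans {f α} {f β} {restrict f S β} (f-cong α≈β)
        (C.sym {restrict f S β} {f β} (restrict-∈ f S β∈S)))
    by-cases (no β∉S) = C.trans {restrict f S α} {0ᶜ} {restrict f S β}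
      (restrict-∉ f S (β∉S ∘ ∈-resp-≈ setoid α≈β))
      (C.sym {restrict f S β} {0ᶜ} (restrict-∉ f S β∉S))

  -- The coefficients g of F cut off outside S, with t added at 0.  The square of
  -- the distance from F to g is ‖F‖² - ∑_S ∣f∣² + t².
  module Truncation (F : H) (S : List Carrier) (uS : Unique S) (0∈S : 0# ∈ S) (t : ℚ) where

    f g : Carrier → ℂ
    z : ℂ
    z = fromℚ t +i 0ᴿ
    f = coeff F
    g α = restrict f S α +ᶜ monomial z 0# α

    g-cong : Σᶜ.Congruent g
    g-cong {α} {β} α≈β =
      C.+-cong {restrict f S α} {restrict f S β} {monomial z 0# α} {monomial z 0# β}
        (restrict-cong f S (coeff-cong F) α≈β) (monomial-cong z 0# α≈β)

    g-supported : Σᶜ.SupportedOn g S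
    g-supported {α} α∉S = C.trans {g α} {0ᶜ +ᶜ 0ᶜ} {0ᶜ}
      (C.+-cong {restrict f S α} {0ᶜ} {monomial z 0# α} {0ᶜ} (restrict-∉ f S α∉S)
        (monomial-≉ z (λ α≈0 → α∉S (∈-resp-≈ setoid (K.sym α≈0) 0∈S))))
      (C.+-identityˡ 0ᶜ)

    [0]⊆S : ∀ {α} → α ∈ 0# ∷ [] → α ∈ S
    [0]⊆S (here α≈0) = ∈-resp-≈ setoid (K.sym α≈0) 0∈S

    sum-g : sumᶜ g S ≈ᶜ sumᶜ f S +ᶜ z
    sum-g = begin
      sumᶜ g S
        ≈⟨ Σᶜ.sum-∙ (restrict f S) (monomial z 0#) S ⟩
      sumᶜ (restrict f S) S +ᶜ sumᶜ (monomial z 0#) S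
        ≈⟨ C.+-cong {sumᶜ (restrict f S) S} {sumᶜ f S} {sumᶜ (monomial z 0#) S} {z}
             (Σᶜ.sum-cong {restrict f S} {f} S (restrict-∈ f S)) (begin
          sumᶜ (monomial z 0#) S
            ≈⟨ Σᶜ.sum-supported {monomial z 0#} (monomial-cong z 0#) (singleton-unique 0#) uS
                 [0]⊆S (monomial-supported z 0#) ⟩
          monomial z 0# 0# +ᶜ 0ᶜ
            ≈⟨ C.+-identityʳ (monomial z 0# 0#) ⟩
          monomial z 0# 0#
            ≈⟨ monomial-≈ z K.refl ⟩
          z ∎) ⟩
      sumᶜ f S +ᶜ z ∎
      where open SetoidReasoning C.setoid

    -- The distance is summed as the norm of F plus a change on S, since outside S
    -- the difference g - f is - f.
    ∣f∣² ∣g-f∣² change : Carrier → ℝ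
    ∣f∣² α   = ∣ f α ∣²
    ∣g-f∣² α = ∣ g α -ᶜ f α ∣²
    change α = ∣g-f∣² α -ᴿ ∣f∣² α

    ∣g-f∣²-cong : Σᴿ.Congruent ∣g-f∣²
    ∣g-f∣²-cong {α} {β} α≈β = ∣-∣²-cong {g α -ᶜ f α} {g β -ᶜ f β}
      (C.+-cong {g α} {g β} { -ᶜ f α} { -ᶜ f β} (g-cong α≈β)
        (C.-‿cong {f α} {f β} (coeff-cong F α≈β)))

    change-cong : Σᴿ.Congruent change
    change-cong {α} {β} α≈β = R.+-cong {∣g-f∣² α} {∣g-f∣² β} { -ᴿ ∣f∣² α} { -ᴿ ∣f∣² β}
      (∣g-f∣²-cong α≈β)
      (R.-‿cong {∣f∣² α} {∣f∣² β} (∣-∣²-cong {f α} {f β} (coeff-cong F α≈β)))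

    change-supported : Σᴿ.SupportedOn change S
    change-supported {α} α∉S = R.trans {change α} {∣f∣² α -ᴿ ∣f∣² α} {0ᴿ}
      (R.+-congʳ { -ᴿ ∣f∣² α} {∣g-f∣² α} {∣f∣² α} (R.trans {∣g-f∣² α} {∣ 0ᶜ -ᶜ f α ∣²} {∣f∣² α}
        (∣-∣²-cong {g α -ᶜ f α} {0ᶜ -ᶜ f α}
          (C.+-congʳ { -ᶜ f α} {g α} {0ᶜ} (g-supported α∉S)))
        (pointwise {∣ 0ᶜ -ᶜ f α ∣²} {∣f∣² α} λ n →
          solve 2 (λ x y → (con 0ℚ :- x) :* (con 0ℚ :- x) :+ (con 0ℚ :- y) :* (con 0ℚ :- y)
            := x :* x :+ y :* y) ≡.refl (seq (re (f α)) n) (seq (im (f α)) n))))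
      (R.-‿inverseʳ (∣f∣² α))

    g-f≈monomial : ∀ {α} → α ∈ S → g α -ᶜ f α ≈ᶜ monomial z 0# α
    g-f≈monomial {α} α∈S = begin
      restrict f S α +ᶜ m -ᶜ f α
        ≈⟨ C.+-congʳ { -ᶜ f α} {restrict f S α +ᶜ m} {f α +ᶜ m}
             (C.+-congʳ {m} {restrict f S α} {f α} (restrict-∈ f S α∈S)) ⟩
      f α +ᶜ m -ᶜ f α
        ≈⟨ pointwiseᶜ {f α +ᶜ m -ᶜ f α} {m}
             (λ n → cancel (seq (re (f α)) n) (seq (re m) n))
             (λ n → cancel (seq (im (f α)) n) (seq (im m) n)) ⟩
      m ∎
      where
      m = monomial z 0# α
      open SetoidReasoning C.setoid
      cancel : ∀ p q → p ℚ.+ q ℚ.- p ≡ q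
      cancel = solve 2 (λ p q → p :+ q :- p := q) ≡.refl

    sum-∣g-f∣² : sumᴿ ∣g-f∣² S ≈ᴿ fromℚ (t ℚ.* t)
    sum-∣g-f∣² = begin
      sumᴿ ∣g-f∣² S
        ≈⟨ Σᴿ.sum-⊇ {∣g-f∣²} ∣g-f∣²-cong (singleton-unique 0#) uS [0]⊆S (λ {α} α∈S α∉[0] →
             ≈0⇒∣-∣²≈0 {g α -ᶜ f α} (C.trans {g α -ᶜ f α} {monomial z 0# α} {0ᶜ}
               (g-f≈monomial α∈S) (monomial-supported z 0# α∉[0]))) ⟩
      ∣g-f∣² 0# +ᴿ 0ᴿ
        ≈⟨ R.+-identityʳ (∣g-f∣² 0#) ⟩
      ∣g-f∣² 0#
        ≈⟨ ∣-∣²-cong {g 0# -ᶜ f 0#} {z} (C.trans {g 0# -ᶜ f 0#} {monomial z 0# 0#} {z}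
             (g-f≈monomial 0∈S) (monomial-≈ z K.refl)) ⟩
      ∣ z ∣²
        ≈⟨ pointwise {∣ z ∣²} {fromℚ (t ℚ.* t)} (λ _ → ℚ.+-identityʳ (t ℚ.* t)) ⟩
      fromℚ (t ℚ.* t) ∎
      where open SetoidReasoning R.setoid

    ∣g-f∣²≈ : ∀ α → ∣g-f∣² α ≈ᴿ ∣f∣² α +ᴿ change α
    ∣g-f∣²≈ α = pointwise {∣g-f∣² α} {∣f∣² α +ᴿ change α} λ n →
      solve 2 (λ p q → p := q :+ (p :- q)) ≡.refl (seq (∣g-f∣² α) n) (seq (∣f∣² α) n)

    HasSum-∣g-f∣² : ∀ {s} → HasSumᴿ setoid ∣f∣² s →
      HasSumᴿ setoid ∣g-f∣² (s +ᴿ sumᴿ change S)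
    HasSum-∣g-f∣² {s} = HasSumᴿ-+finite setoid ∣f∣² ∣g-f∣² change S {s} change-cong uS
      change-supported ∣g-f∣²≈

    sum-change : sumᴿ change S ≈ᴿ fromℚ (t ℚ.* t) -ᴿ sumᴿ ∣f∣² S
    sum-change = begin
      C′
        ≈⟨ pointwise {C′} {(Φ +ᴿ C′) -ᴿ Φ} (λ n →
             solve 2 (λ p q → p := (q :+ p) :- q) ≡.refl (seq C′ n) (seq Φ n)) ⟩
      (Φ +ᴿ C′) -ᴿ Φ
        ≈⟨ R.+-congʳ { -ᴿ Φ} {Φ +ᴿ C′} {fromℚ (t ℚ.* t)} (begin
             Φ +ᴿ C′
               ≈⟨ Σᴿ.sum-∙ ∣f∣² change S ⟨
             sumᴿ (λ α → ∣f∣² α +ᴿ change α) S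
               ≈⟨ Σᴿ.sum-cong {∣g-f∣²} {λ α → ∣f∣² α +ᴿ change α} S (λ {α} _ → ∣g-f∣²≈ α) ⟨
             sumᴿ ∣g-f∣² S
               ≈⟨ sum-∣g-f∣² ⟩
             fromℚ (t ℚ.* t) ∎) ⟩
      fromℚ (t ℚ.* t) -ᴿ Φ ∎
      where
      C′ = sumᴿ change S
      Φ  = sumᴿ ∣f∣² S
      open SetoidReasoning R.setoid

  approximation : ∀ F ε → 0ᴿ <ᴿ ε → ∃[ G ] P G × ‖ rep G - F ‖< ε
  approximation F ε (e , e>0 , N , e<ε) =
    let d , d>0 , 2d = halve e>0
        s , F-sum = coeff-ℓ² F
        S₀ , close = F-sum (fromℚ (d ℚ.* d)) (fromℚ-pos (0<* d>0 d>0))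
        -- S₀ carries ‖F‖² up to d²; the index 0 is added so that t can be placed
        -- there.
        S , uS , S₀⊆S , [0]⊆S = Σᴿ.enlarge _≟_ S₀ (0# ∷ [])
        0∈S = [0]⊆S (here K.refl)
        t , t²≡d² , sum+t≉0 = perturb (re (sumᶜ (coeff F) S)) d>0
        module T = Truncation F S uS 0∈S t
        G = polynomial T.g S T.g-cong uS T.g-supported
        sumG≉0 : ¬ (sumᶜ T.g S ≈ᶜ 0ᶜ)
        sumG≉0 sumG≈0 = sum+t≉0 (proj₁ (C.trans {sumᶜ (coeff F) S +ᶜ T.z} {sumᶜ T.g S} {0ᶜ}
          (C.sym {sumᶜ T.g S} {sumᶜ (coeff F) S +ᶜ T.z} T.sum-g) sumG≈0))
        D = fromℚ (d ℚ.* d)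
        Φ = sumᴿ T.∣f∣² S
        s′ = s +ᴿ sumᴿ T.change S
        s+D-Φ≈s′ : s +ᴿ (D -ᴿ Φ) ≈ᴿ s′
        s+D-Φ≈s′ = R.+-congˡ {s} {D -ᴿ Φ} {sumᴿ T.change S}
          (R.sym {sumᴿ T.change S} {D -ᴿ Φ}
            (≡.subst (λ q → sumᴿ T.change S ≈ᴿ fromℚ q -ᴿ Φ) t²≡d² T.sum-change))
    in toℙ G S sumG≉0 , (S , uS , T.g-supported , sumG≉0) , s′ , T.HasSum-∣g-f∣² {s} F-sum
     , <ᴿ-respˡ-≈ᴿ {s +ᴿ (D -ᴿ Φ)} {s′} {ε *ᴿ ε} s+D-Φ≈s′
         (truncation-estimate {s} {Φ} {ε} d>0
           (N , λ n n≥ → ≡.subst (ℚ._< seq ε n) (≡.trans (ℚ.+-identityˡ e) (≡.sym 2d)) (e<ε n n≥))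
           (close S uS S₀⊆S))

  P-dense : ∀ v → DenseIn v N P
  P-dense v V (_ , open-V) F _ VF =
    let ε , ε>0 , ball = open-V F VF
        G , PG , near = approximation (rep F) ε ε>0
    in G , P⊆N {G} PG , PG , ball G near

  -- Multiplication by a monomial

  x*[x⁻¹*y]≈y : ∀ {x x⁻¹} → x * x⁻¹ ≈ 1# → ∀ y → x * (x⁻¹ * y) ≈ y
  x*[x⁻¹*y]≈y {x} {x⁻¹} xx⁻¹≈1 y = begin
    x * (x⁻¹ * y)   ≈⟨ *-assoc x x⁻¹ y ⟨
    x * x⁻¹ * y     ≈⟨ *-congʳ xx⁻¹≈1 ⟩
    1# * y          ≈⟨ *-identityˡ y ⟩
    y               ∎
    where open SetoidReasoning setoid

  x⁻¹*[x*y]≈y : ∀ {x x⁻¹} → x * x⁻¹ ≈ 1# → ∀ y → x⁻¹ * (x * y) ≈ y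
  x⁻¹*[x*y]≈y {x} {x⁻¹} xx⁻¹≈1 = x*[x⁻¹*y]≈y (K.trans (*-comm x⁻¹ x) xx⁻¹≈1)

  -- If A is the monomial ϱ^ν with ν a unit of inverse μ, then the coefficient of
  -- A ⊗ F at α is that of F at μ α.  The only factorization of α with a nonzero
  -- term is ν · (μ α); this includes α = 0.
  module MonomialProduct (A F D : H) (ν μ : Carrier) (νμ≈1 : ν * μ ≈ 1#)
    (A≈ : ∀ β → coeff A β ≈ᶜ monomial 1ᶜ ν β) (D≈ : ∀ α → coeff D α ≈ᶜ coeff F (μ * α)) where

    private
      a f d : Carrier → ℂ
      a = coeff A
      f = coeff F
      d = coeff D

    module _ (α : Carrier) where

      only : Setoid.Carrier (GradedHolomorphic.factorizations K α)
      only = (ν , μ * α) , x*[x⁻¹*y]≈y νμ≈1 α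

      term-cong : Sumᶜ.Congruent (GradedHolomorphic.factorizations K α) (GradedHolomorphic.term K A F α)
      term-cong {(β , γ) , _} {(β′ , γ′) , _} (β≈β′ , γ≈γ′) =
        C.*-cong {a β} {a β′} {f γ} {f γ′} (coeff-cong A β≈β′) (coeff-cong F γ≈γ′)

      term-supported : Sumᶜ.SupportedOn (GradedHolomorphic.factorizations K α)
        (GradedHolomorphic.term K A F α) (only ∷ [])
      term-supported {(β , γ) , βγ≈α} ∉only = C.trans {a β *ᶜ f γ} {0ᶜ *ᶜ f γ} {0ᶜ}
        (C.*-congʳ {f γ} {a β} {0ᶜ} (C.trans {a β} {monomial 1ᶜ ν β} {0ᶜ} (A≈ β)
          (monomial-≉ 1ᶜ λ β≈ν → ∉only (here (β≈ν , (begin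
            γ             ≈⟨ x⁻¹*[x*y]≈y νμ≈1 γ ⟨
            μ * (ν * γ)   ≈⟨ *-congˡ (*-congʳ β≈ν) ⟨
            μ * (β * γ)   ≈⟨ *-congˡ βγ≈α ⟩
            μ * α         ∎))))))
        (C.zeroˡ (f γ))
        where open SetoidReasoning setoid

      term-only : a ν *ᶜ f (μ * α) ≈ᶜ d α
      term-only = begin
        a ν *ᶜ f (μ * α)
          ≈⟨ C.*-congʳ {f (μ * α)} {a ν} {1ᶜ}
               (C.trans {a ν} {monomial 1ᶜ ν ν} {1ᶜ} (A≈ ν) (monomial-≈ 1ᶜ K.refl)) ⟩
        1ᶜ *ᶜ f (μ * α)
          ≈⟨ C.*-identityˡ (f (μ * α)) ⟩
        f (μ * α)
          ≈⟨ D≈ α ⟨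
        d α ∎
        where open SetoidReasoning C.setoid

    isDirichletProduct : GradedHolomorphic.IsDirichletProduct K A F D
    isDirichletProduct =
        AbsSummable-single (GradedHolomorphic.factorizations K 0#) (GradedHolomorphic.term K A F 0#)
          (only 0#) (λ {i} {j} → term-cong 0# {i} {j}) (λ {i} → term-supported 0# {i})
      , λ α → HasSumᶜ-single (GradedHolomorphic.factorizations K α) (GradedHolomorphic.term K A F α)
          (only α) {coeff D α} (λ {i} {j} → term-cong α {i} {j}) (λ {i} → term-supported α {i})
          (term-only α)

  monomial-product : ∀ A F D {ν μ} → ν * μ ≈ 1# →
    (∀ β → coeff (rep A) β ≈ᶜ monomial 1ᶜ ν β) →
    (∀ α → coeff (rep D) α ≈ᶜ coeff (rep F) (μ * α)) → [ A ]⊗[ F ]≡[ D ]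
  monomial-product A F D {ν} {μ} νμ≈1 A≈ D≈ = rep D
    , MonomialProduct.isDirichletProduct (rep A) (rep F) (rep D) ν μ νμ≈1 A≈ D≈
    , 1ᶜ , (1ᶜ , C.*-identityˡ 1ᶜ)
    , λ α → C.sym {1ᶜ *ᶜ coeff (rep D) α} {coeff (rep D) α} (C.*-identityˡ (coeff (rep D) α))

  -- For F supported on S with nonzero sum, the elements A = ϱ^ν and
  -- D = ∑ a_α ϱ^(ν α), the latter supported on T = ν S.
  module Multiple (F : H) (S : List Carrier) (uS : Unique S) (F≈0 : Σᶜ.SupportedOn (coeff F) S)
    (sum≉0 : ¬ (sumᶜ (coeff F) S ≈ᶜ 0ᶜ))
    (ν μ : Carrier) (νμ≈1 : ν * μ ≈ 1#) where

    a f d : Carrier → ℂ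
    a = monomial 1ᶜ ν
    f = coeff F
    d α = f (μ * α)

    A : H
    A = polynomial a (ν ∷ []) (monomial-cong 1ᶜ ν) (singleton-unique ν) (monomial-supported 1ᶜ ν)

    sum-a≈1 : sumᶜ a (ν ∷ []) ≈ᶜ 1ᶜ
    sum-a≈1 = C.trans {a ν +ᶜ 0ᶜ} {a ν} {1ᶜ} (C.+-identityʳ (a ν)) (monomial-≈ 1ᶜ K.refl)

    T : List Carrier
    T = map (ν *_) S

    uT : Unique T
    uT = Unique.map⁺ setoid setoid
      (λ {α} {β} να≈νβ → K.trans (K.sym (x⁻¹*[x*y]≈y νμ≈1 α)) (K.trans (*-congˡ να≈νβ) (x⁻¹*[x*y]≈y νμ≈1 β))) uS

    d-cong : Σᶜ.Congruent d
    d-cong α≈β = coeff-cong F (*-congˡ α≈β)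

    d-supported : Σᶜ.SupportedOn d T
    d-supported {α} α∉T = F≈0 λ μα∈S → α∉T (∈-resp-≈ setoid (x*[x⁻¹*y]≈y νμ≈1 α)
      (∈-map⁺ setoid setoid *-congˡ μα∈S))

    D : H
    D = polynomial d T d-cong uT d-supported

    sum-map : ∀ S → sumᶜ d (map (ν *_) S) ≈ᶜ sumᶜ f S
    sum-map []      = C.refl {0ᶜ}
    sum-map (α ∷ S) = C.+-cong {d (ν * α)} {f α} {sumᶜ d (map (ν *_) S)} {sumᶜ f S}
      (coeff-cong F (x⁻¹*[x*y]≈y νμ≈1 α)) (sum-map S)

    sum-d≉0 : ¬ (sumᶜ d T ≈ᶜ 0ᶜ)
    sum-d≉0 sum≈0 = sum≉0 (C.trans {sumᶜ f S} {sumᶜ d T} {0ᶜ}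
      (C.sym {sumᶜ d T} {sumᶜ f S} (sum-map S)) sum≈0)

  P-integral⇒N[O] : ∀ F ((S , _) : P F) → (∀ {α} → α ∈ S → IsIntegral α) → N[O] F
  P-integral⇒N[O] F PF@(S , _ , F≈0 , _) integral =
    P⊆N {F} PF , λ α ¬integral → F≈0 (¬integral ∘ integral)

  1ᶜ≉0ᶜ : ¬ (1ᶜ ≈ᶜ 0ᶜ)
  1ᶜ≉0ᶜ (1≈0 , _) = never (eventually-map (λ _ → ℚ.<-irrefl ≡.refl) (1≈0 1ℚ (ℚ.positive⁻¹ 1ℚ)))

  P-integral-multiple : ∀ F → P F →
    ∃[ A ] N[O] A × (∃[ D ] N[O] D × [ A ]⊗[ F ]≡[ D ])
  P-integral-multiple F (S , uS , F≈0 , sum≉0) =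
      𝔸
    , P-integral⇒N[O] 𝔸 (ν ∷ [] , singleton-unique ν , monomial-supported 1ᶜ ν , sum-a≉0)
        (λ { (here α≈ν) → IsIntegral-cong (K.sym α≈ν) (integer-integral n) })
    , 𝔻
    , P-integral⇒N[O] 𝔻 (M.T , M.uT , M.d-supported , M.sum-d≉0)
        (T-integral dens)
    , monomial-product 𝔸 F 𝔻 νμ≈1 (λ β → C.refl {M.a β}) (λ α → C.refl {M.d α})
    where
    n = proj₁ (common-denominator S)
    n≢0 = proj₁ (proj₂ (common-denominator S))
    dens = proj₂ (proj₂ (common-denominator S))
    ν = ⟦ n ⟧
    μ = proj₁ (⟦⟧-unit n≢0)
    νμ≈1 = proj₂ (⟦⟧-unit n≢0)
    module M = Multiple (rep F) S uS F≈0 sum≉0 ν μ νμ≈1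
    sum-a≉0 : ¬ (sumᶜ M.a (ν ∷ []) ≈ᶜ 0ᶜ)
    sum-a≉0 sum≈0 = 1ᶜ≉0ᶜ (C.trans {1ᶜ} {sumᶜ M.a (ν ∷ [])} {0ᶜ}
      (C.sym {sumᶜ M.a (ν ∷ [])} {1ᶜ} M.sum-a≈1) sum≈0)
    𝔸 𝔻 : ℙH
    𝔸 = toℙ M.A (ν ∷ []) sum-a≉0
    𝔻 = toℙ M.D M.T M.sum-d≉0
    T-integral : ∀ {S α} → All (IsDenominator n) S → α ∈ map (ν *_) S → IsIntegral α
    T-integral (den ∷ _) (here α≈) =
      IsIntegral-cong (K.sym α≈) (denominator⇒integral n≢0 den)
    T-integral (_ ∷ dens) (there α∈) = T-integral dens α∈

theorem7 : ∀ {c ℓ₁ ℓ₂} v (K : AlgebraicNumberField c ℓ₁ ℓ₂) →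
    let open GradedHolomorphic K in
    Σ[ P ∈ Pred ℙH (c ⊔ ℓ₁) ]
    P Respects _∼_ × P ⊆ N × DenseIn v N P ×
    (∀ F → P F →
    ∃[ A ] N[O] A × (∃[ D ] N[O] D × [ A ]⊗[ F ]≡[ D ]))
theorem7 v K = P , (λ {F} {G} → P-respects-∼ {F} {G}) , (λ {F} → P⊆N {F})
  , P-dense v , P-integral-multiple
  where open Density K
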